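{- Let $p$ be a prime, let $(G_i)_{i\in I}$ be a (not necessarily finite) family of pro-$p$ groups and let $G=\coprod_{i\in I}G_i$ be its free pro-$p$ product. Then $G$ has the $p$-Kijima--Nishi property if and only if all the $G_i$ have the $p$-Kijima--Nishi property.
   Context: For a profinite group $G$, $\mathrm{H}^n(G,\mathbb{F}_p)$ is continuous cohomology with trivial coefficients and $$\mathcal{R}_p(G)=\{\alpha\in \mathrm{H}^1(G,\mathbb{F}_p) : \alpha\smile\beta=0 \text{ for all }\beta\in \mathrm{H}^1(G,\mathbb{F}_p)\}.$$ For an open subgroup $U\le G$, corestriction maps $\mathcal{R}_p(U)$ into $\mathcal{R}_p(G)$, inducing $c_{U,G}:\mathcal{R}_p(U)\to\mathcal{R}_p(G)$. $G$ has the $p$-Kijima--Nishi property if $c_{U,G}$ is surjective for every open normal subgroup $U$ of index $p$. The free pro-$p$ product of a family $(G_i)_{i\in I}$ of pro-$p$ groups (in the sense of Neukirch--Schmidt--Wingberg, Ch. IV, \S 1) is $\varprojlim_N (\ast_{i\in I}G_i)/N$, where $\ast_{i\in I}G_i$ is the abstract free product and $N$ runs over the normal subgroups of $p$-power index such that $N\cap G_i$ is open in $G_i$ for all $i$ and $G_i\subseteq N$ for all but finitely many $i$. -}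

module Defs where

open import Level using (Level; _⊔_; 0ℓ; Lift; lift) renaming (suc to lsuc)
open import Algebra.Bundles using (Group; CommutativeRing)
open import Algebra.Morphism.Structures using (module GroupMorphisms)
import Algebra.Properties.CommutativeMonoid.Sum as Sums
import Algebra.Properties.Group as GroupProperties
import Algebra.Properties.Semiring.Exp as Exp
open import Data.Fin.Base using (Fin; toℕ; cast; _↑ˡ_; _↑ʳ_)
open import Data.Integer.Base as ℤ using (ℤ)
import Data.Integer.Properties as ℤ
open import Data.Integer.Divisibility.Signed as ℤ∣ using (divides)
open import Data.Integer.Tactic.RingSolver using (solve-∀)
open import Data.List.Base using (List; []; _∷_; _++_; [_])
open import Data.List.Membership.Propositional using (_∉_)
import Data.List.Properties as List
open import Data.List.Relation.Unary.All as All using (All)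
import Data.List.Relation.Unary.All.Properties as All
open import Data.Nat.Base using (ℕ; zero; suc; _+_; _^_)
import Data.Nat.Properties as ℕ
open import Data.Product using (Σ; _×_; _,_; proj₁; proj₂; ∃; ∃-syntax)
open import Data.Unit.Base using (⊤; tt)
open import Data.Vec.Functional using (Vector; removeAt)
open import Function.Base using (_∘_; id)
open import Function.Bundles using (Inverse)
open import Relation.Binary.Bundles using (Setoid)
open import Relation.Binary.Core using (Rel)
open import Relation.Binary.Definitions using (Reflexive; Transitive; _Respects_)
open import Relation.Binary.PropositionalEquality as ≡ using (_≡_)
open import Relation.Unary using (Pred; _∩_; _⊆_)

private
  variable
    a r c ℓ c′ ℓ′ i s : Level

------------------------------------------------------------------------
-- 𝔽 p is ℤ with equality replaced by congruence modulo p

module _ (p : ℕ) where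

  infix 4 _≡ₚ_
  _≡ₚ_ : Rel ℤ 0ℓ
  x ≡ₚ y = (ℤ.+ p) ℤ∣.∣ (x ℤ.- y)

  private
    ≡⇒≡ₚ : ∀ {x y} → x ≡ y → x ≡ₚ y
    ≡⇒≡ₚ {x} ≡.refl = ≡.subst (_ ℤ∣.∣_) (≡.sym (ℤ.+-inverseʳ x)) (divides ℤ.0ℤ ≡.refl)

    sym-eq : ∀ x y → ℤ.- (x ℤ.- y) ≡ y ℤ.- x
    sym-eq = solve-∀

    trans-eq : ∀ x y z → (x ℤ.- y) ℤ.+ (y ℤ.- z) ≡ x ℤ.- z
    trans-eq = solve-∀

    +-eq : ∀ x y u v → (x ℤ.- y) ℤ.+ (u ℤ.- v) ≡ (x ℤ.+ u) ℤ.- (y ℤ.+ v)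
    +-eq = solve-∀

    *-eq : ∀ x y u v →
           x ℤ.* (u ℤ.- v) ℤ.+ (x ℤ.- y) ℤ.* v ≡ (x ℤ.* u) ℤ.- (y ℤ.* v)
    *-eq = solve-∀

    neg-eq : ∀ x y → ℤ.- (x ℤ.- y) ≡ (ℤ.- x) ℤ.- (ℤ.- y)
    neg-eq = solve-∀

  𝔽 : CommutativeRing 0ℓ 0ℓ
  𝔽 = record
    { Carrier = ℤ
    ; _≈_ = _≡ₚ_
    ; _+_ = ℤ._+_
    ; _*_ = ℤ._*_
    ; -_ = ℤ.-_
    ; 0# = ℤ.0ℤ
    ; 1# = ℤ.1ℤ
    ; isCommutativeRing = record
      { isRing = record
        { +-isAbelianGroup = record
          { isGroup = record
            { isMonoid = record
              { isSemigroup = record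
                { isMagma = record
                  { isEquivalence = record
                    { refl = λ {x} → ≡⇒≡ₚ {x} ≡.refl
                    ; sym = λ {x} {y} e →
                        ≡.subst (_ ℤ∣.∣_) (sym-eq x y) (ℤ∣.∣m⇒∣-m e)
                    ; trans = λ {x} {y} {z} e f →
                        ≡.subst (_ ℤ∣.∣_) (trans-eq x y z) (ℤ∣.∣m∣n⇒∣m+n e f)
                    }
                  ; ∙-cong = λ {x} {y} {u} {v} e f →
                      ≡.subst (_ ℤ∣.∣_) (+-eq x y u v) (ℤ∣.∣m∣n⇒∣m+n e f)
                  }
                ; assoc = λ x y z → ≡⇒≡ₚ (ℤ.+-assoc x y z)
                }
              ; identity = (λ x → ≡⇒≡ₚ (ℤ.+-identityˡ x))
                         , (λ x → ≡⇒≡ₚ (ℤ.+-identityʳ x))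
              }
            ; inverse = (λ x → ≡⇒≡ₚ (ℤ.+-inverseˡ x))
                      , (λ x → ≡⇒≡ₚ (ℤ.+-inverseʳ x))
            ; ⁻¹-cong = λ {x} {y} e →
                ≡.subst (_ ℤ∣.∣_) (neg-eq x y) (ℤ∣.∣m⇒∣-m e)
            }
          ; comm = λ x y → ≡⇒≡ₚ (ℤ.+-comm x y)
          }
        ; *-cong = λ {x} {y} {u} {v} e f →
            ≡.subst (_ ℤ∣.∣_) (*-eq x y u v)
              (ℤ∣.∣m∣n⇒∣m+n (ℤ∣.∣n⇒∣m*n x f) (ℤ∣.∣m⇒∣m*n v e))
        ; *-assoc = λ x y z → ≡⇒≡ₚ (ℤ.*-assoc x y z)
        ; *-identity = (λ x → ≡⇒≡ₚ (ℤ.*-identityˡ x))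
                     , (λ x → ≡⇒≡ₚ (ℤ.*-identityʳ x))
        ; distrib = (λ x y z → ≡⇒≡ₚ (ℤ.*-distribˡ-+ x y z))
                  , (λ x y z → ≡⇒≡ₚ (ℤ.*-distribʳ-+ x y z))
        }
      ; *-comm = λ x y → ≡⇒≡ₚ (ℤ.*-comm x y)
      }
    }

------------------------------------------------------------------------
-- Subgroups, cosets, quotients

module _ (G : Group c ℓ) where
  open Group G

  record Subgroup s : Set (c ⊔ ℓ ⊔ lsuc s) where
    field
      Mem       : Pred Carrier s
      resp      : Mem Respects _≈_
      ε-mem     : Mem ε
      ∙-closed  : ∀ {x y} → Mem x → Mem y → Mem (x ∙ y)
      ⁻¹-closed : ∀ {x} → Mem x → Mem (x ⁻¹)

  Normal : Subgroup s → Set (c ⊔ s)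
  Normal N = ∀ g {x} → Mem x → Mem (g ∙ x ∙ g ⁻¹)
    where open Subgroup N

module _ {G : Group c ℓ} (U : Subgroup G s) where
  open Group G
  open Subgroup U
  open GroupProperties G
  open import Relation.Binary.Reasoning.Setoid setoid

  -- The right cosets U g: equality of U x and U y means x y⁻¹ ∈ U.
  rightCosets : Setoid c s
  rightCosets = record
    { Carrier = Carrier
    ; _≈_ = λ x y → Mem (x // y)
    ; isEquivalence = record
      { refl = λ {x} → resp (sym (inverseʳ x)) ε-mem
      ; sym = λ {x} {y} m → resp (flip// x y) (⁻¹-closed m)
      ; trans = λ {x} {y} {z} m n → resp (cancel x y z) (∙-closed m n)
      }
    }
    where
    flip// : ∀ x y → (x // y) ⁻¹ ≈ y // x
    flip// x y = begin
      (x ∙ y ⁻¹) ⁻¹    ≈⟨ ⁻¹-anti-homo-∙ x (y ⁻¹) ⟩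
      y ⁻¹ ⁻¹ ∙ x ⁻¹   ≈⟨ ∙-congʳ (⁻¹-involutive y) ⟩
      y ∙ x ⁻¹         ∎

    cancel : ∀ x y z → (x // y) ∙ (y // z) ≈ x // z
    cancel x y z = begin
      (x ∙ y ⁻¹) ∙ (y ∙ z ⁻¹)   ≈⟨ assoc x (y ⁻¹) (y ∙ z ⁻¹) ⟩
      x ∙ (y ⁻¹ ∙ (y ∙ z ⁻¹))   ≈⟨ ∙-congˡ (assoc (y ⁻¹) y (z ⁻¹)) ⟨
      x ∙ (y ⁻¹ ∙ y ∙ z ⁻¹)     ≈⟨ ∙-congˡ (∙-congʳ (inverseˡ y)) ⟩
      x ∙ (ε ∙ z ⁻¹)            ≈⟨ ∙-congˡ (identityˡ (z ⁻¹)) ⟩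
      x ∙ z ⁻¹                  ∎

  -- An inhabitant also chooses a representative in each coset.
  HasIndex : ℕ → Set (c ⊔ s)
  HasIndex k = Inverse rightCosets (≡.setoid (Fin k))

  subgroupGroup : Group (c ⊔ s) ℓ
  subgroupGroup = record
    { Carrier = Σ Carrier Mem
    ; _≈_ = λ x y → proj₁ x ≈ proj₁ y
    ; _∙_ = λ x y → proj₁ x ∙ proj₁ y , ∙-closed (proj₂ x) (proj₂ y)
    ; ε = ε , ε-mem
    ; _⁻¹ = λ x → proj₁ x ⁻¹ , ⁻¹-closed (proj₂ x)
    ; isGroup = record
      { isMonoid = record
        { isSemigroup = record
          { isMagma = record
            { isEquivalence = record { refl = refl ; sym = sym ; trans = trans }
            ; ∙-cong = ∙-cong
            }
          ; assoc = λ x y z → assoc _ _ _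
          }
        ; identity = (λ x → identityˡ _) , (λ x → identityʳ _)
        }
      ; inverse = (λ x → inverseˡ _) , (λ x → inverseʳ _)
      ; ⁻¹-cong = ⁻¹-cong
      }
    }

  module _ (normal : Normal G U) where

    private
      module Q = Setoid rightCosets

      ≈⇒Q : ∀ {x y} → x ≈ y → x Q.≈ y
      ≈⇒Q {x} {y} e = resp (sym (trans (∙-congʳ e) (inverseʳ y))) ε-mem

      conj-eq : ∀ x y u v → (x // y) ∙ (y ∙ (u // v) ∙ y ⁻¹) ≈ (x ∙ u) // (y ∙ v)
      conj-eq x y u v = begin
        (x ∙ y ⁻¹) ∙ (y ∙ (u ∙ v ⁻¹) ∙ y ⁻¹)   ≈⟨ assoc x (y ⁻¹) _ ⟩
        x ∙ (y ⁻¹ ∙ (y ∙ (u ∙ v ⁻¹) ∙ y ⁻¹))   ≈⟨ ∙-congˡ (∙-congˡ (assoc y (u ∙ v ⁻¹) (y ⁻¹))) ⟩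
        x ∙ (y ⁻¹ ∙ (y ∙ (u ∙ v ⁻¹ ∙ y ⁻¹)))   ≈⟨ ∙-congˡ (assoc (y ⁻¹) y _) ⟨
        x ∙ (y ⁻¹ ∙ y ∙ (u ∙ v ⁻¹ ∙ y ⁻¹))     ≈⟨ ∙-congˡ (∙-congʳ (inverseˡ y)) ⟩
        x ∙ (ε ∙ (u ∙ v ⁻¹ ∙ y ⁻¹))            ≈⟨ ∙-congˡ (identityˡ _) ⟩
        x ∙ (u ∙ v ⁻¹ ∙ y ⁻¹)                  ≈⟨ ∙-congˡ (assoc u (v ⁻¹) (y ⁻¹)) ⟩
        x ∙ (u ∙ (v ⁻¹ ∙ y ⁻¹))                ≈⟨ assoc x u _ ⟨
        x ∙ u ∙ (v ⁻¹ ∙ y ⁻¹)                  ≈⟨ ∙-congˡ (⁻¹-anti-homo-∙ y v) ⟨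
        x ∙ u ∙ (y ∙ v) ⁻¹                     ∎

      inv-eq : ∀ x y → x ⁻¹ ∙ (y // x) ∙ x ⁻¹ ⁻¹ ≈ (x ⁻¹) // (y ⁻¹)
      inv-eq x y = begin
        x ⁻¹ ∙ (y ∙ x ⁻¹) ∙ x ⁻¹ ⁻¹     ≈⟨ assoc _ _ _ ⟩
        x ⁻¹ ∙ (y ∙ x ⁻¹ ∙ x ⁻¹ ⁻¹)     ≈⟨ ∙-congˡ (assoc _ _ _) ⟩
        x ⁻¹ ∙ (y ∙ (x ⁻¹ ∙ x ⁻¹ ⁻¹))   ≈⟨ ∙-congˡ (∙-congˡ (inverseʳ _)) ⟩
        x ⁻¹ ∙ (y ∙ ε)                  ≈⟨ ∙-congˡ (identityʳ y) ⟩
        x ⁻¹ ∙ y                        ≈⟨ ∙-congˡ (⁻¹-involutive y) ⟨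
        x ⁻¹ ∙ y ⁻¹ ⁻¹                  ∎

    quotient : Group c s
    quotient = record
      { Carrier = Carrier
      ; _≈_ = Q._≈_
      ; _∙_ = _∙_
      ; ε = ε
      ; _⁻¹ = _⁻¹
      ; isGroup = record
        { isMonoid = record
          { isSemigroup = record
            { isMagma = record
              { isEquivalence = Q.isEquivalence
              ; ∙-cong = λ {x} {y} {u} {v} m n →
                  resp (conj-eq x y u v) (∙-closed m (normal y n))
              }
            ; assoc = λ x y z → ≈⇒Q (assoc x y z)
            }
          ; identity = (λ x → ≈⇒Q (identityˡ x)) , (λ x → ≈⇒Q (identityʳ x))
          }
        ; inverse = (λ x → ≈⇒Q (inverseˡ x)) , (λ x → ≈⇒Q (inverseʳ x))
        ; ⁻¹-cong = λ {x} {y} m → resp (inv-eq x y) (normal (x ⁻¹) (Q.sym {x} {y} m))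
        }
      }

------------------------------------------------------------------------
-- Topological groups

-- Subsets are predicates with values in Set ℓ; under excluded middle at every
-- level this loses no subsets.
record TopologicalGroup c ℓ : Set (lsuc (c ⊔ ℓ)) where
  field
    group : Group c ℓ
  open Group group public
  field
    IsOpen    : Pred (Pred Carrier ℓ) (c ⊔ ℓ)
    open-resp : ∀ {V} → IsOpen V → V Respects _≈_
    open-⊤    : IsOpen (λ _ → Lift ℓ ⊤)
    open-∩    : ∀ {V W} → IsOpen V → IsOpen W → IsOpen (V ∩ W)
    -- A set containing an open neighbourhood of each of its points is open;
    -- this is stability under arbitrary unions.
    open-⋃    : ∀ {V} → (∀ x → V x → ∃[ W ] IsOpen W × W x × W ⊆ V) → IsOpen V
    ∙-cont    : ∀ {V} x y → IsOpen V → V (x ∙ y) →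
                ∃[ W ] ∃[ W′ ] IsOpen W × IsOpen W′ × W x × W′ y ×
                  (∀ {x′ y′} → W x′ → W′ y′ → V (x′ ∙ y′))
    ⁻¹-cont   : ∀ {V} x → IsOpen V → V (x ⁻¹) →
                ∃[ W ] IsOpen W × W x × (∀ {x′} → W x′ → V (x′ ⁻¹))

  open-ext : ∀ {V W} → V ⊆ W → W ⊆ V → IsOpen V → IsOpen W
  open-ext {V} V⊆W W⊆V oV = open-⋃ λ x Wx → V , oV , W⊆V Wx , V⊆W

record OpenSubgroup (G : TopologicalGroup c ℓ) : Set (c ⊔ lsuc ℓ) where
  open TopologicalGroup G
  field
    subgroup : Subgroup group ℓ
    isOpen   : IsOpen (Subgroup.Mem subgroup)
  open Subgroup subgroup public

module _ {G : TopologicalGroup c ℓ} (U : OpenSubgroup G) where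
  open TopologicalGroup G
  open OpenSubgroup U

  image : Pred (Σ Carrier Mem) ℓ → Pred Carrier ℓ
  image V g = Σ (Mem g) λ m → V (g , m)

  restrict : Pred Carrier ℓ → Pred (Σ Carrier Mem) ℓ
  restrict V (g , _) = V g

  Resp : Pred (Σ Carrier Mem) ℓ → Set (c ⊔ ℓ)
  Resp V = ∀ {x y} → proj₁ x ≈ proj₁ y → V x → V y

  restrict-open : ∀ {V} → IsOpen V → Resp (restrict V) × IsOpen (image (restrict V))
  restrict-open oV = open-resp oV , open-∩ isOpen oV

  -- Since U is open in G, its subspace topology consists of the subsets of U
  -- that are open in G.  The first component of IsOpen makes V independent of
  -- the proofs of membership in U.
  openSubgroup : TopologicalGroup (c ⊔ ℓ) ℓ
  openSubgroup = record
    { group = subgroupGroup subgroup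
    ; IsOpen = λ V → Resp V × IsOpen (image V)
    ; open-resp = λ (rV , _) → rV
    ; open-⊤ = (λ _ _ → lift tt)
             , open-ext (λ m → m , lift tt) proj₁ isOpen
    ; open-∩ = λ (rV , oV) (rW , oW) →
          (λ e (v , w) → rV e v , rW e w)
        , open-ext (λ ((m , v) , (_ , w)) → m , v , rW refl w)
                   (λ (m , v , w) → (m , v) , (m , w))
                   (open-∩ oV oW)
    ; open-⋃ = λ {V} loc →
          (λ {x} {y} e v → let (W , (rW , _) , w , W⊆V) = loc x v in W⊆V (rW e w))
        , open-⋃ λ x (m , v) → let (W , (_ , oW) , w , W⊆V) = loc (x , m) v in
            image W , oW , (m , w) , λ (m′ , w′) → m′ , W⊆V w′
    ; ∙-cont = λ (x , m) (y , n) (rV , oV) v →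
        let (W , W′ , oW , oW′ , w , w′ , h) = ∙-cont x y oV (_ , v) in
        restrict W , restrict W′ , restrict-open oW , restrict-open oW′ , w , w′ ,
        λ a b → rV refl (proj₂ (h a b))
    ; ⁻¹-cont = λ (x , m) (rV , oV) v →
        let (W , oW , w , h) = ⁻¹-cont x oV (_ , v) in
        restrict W , restrict-open oW , w , λ a → rV refl (proj₂ (h a))
    }

------------------------------------------------------------------------
-- Continuous cohomology, by homogeneous cochains, with coefficients in a
-- discrete commutative ring with trivial action

module Cohomology (A : CommutativeRing 0ℓ 0ℓ) (G : TopologicalGroup c ℓ) where
  private module A = CommutativeRing A
  open TopologicalGroup G
  open Sums A.+-commutativeMonoid using (sum)
  open Exp A.semiring using () renaming (_^_ to _^ᴬ_)

  -- Continuity of a map from a power of G (with the product topology) to the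
  -- discrete space A, that is, local constancy.
  Continuous : ∀ {n} → (Vector Carrier n → A.Carrier) → Set (c ⊔ lsuc ℓ)
  Continuous {n} f = ∀ x → Σ (Vector (Pred Carrier ℓ) n) λ V →
    (∀ k → IsOpen (V k)) × (∀ k → V k (x k)) ×
    (∀ y → (∀ k → V k (y k)) → f y A.≈ f x)

  -- Compatibility with equality in G follows from continuity and open-resp.
  record Cochain n : Set (c ⊔ lsuc ℓ) where
    field
      fun        : Vector Carrier (suc n) → A.Carrier
      continuous : Continuous fun
      invariant  : ∀ g x → fun (λ k → g ∙ x k) A.≈ fun x

  δ : ∀ {n} → (Vector Carrier (suc n) → A.Carrier) →
      Vector Carrier (suc (suc n)) → A.Carrier
  δ f x = sum λ k → ((A.- A.1#) ^ᴬ toℕ k) A.* f (removeAt x k)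

  record Cocycle n : Set (c ⊔ lsuc ℓ) where
    field
      cochain : Cochain n
    open Cochain cochain public
    field
      closed : ∀ x → δ fun x A.≈ A.0#

  -- f vanishes in the cohomology of degree n
  IsCoboundary : ∀ {n} → (Vector Carrier (suc n) → A.Carrier) → Set (c ⊔ lsuc ℓ)
  IsCoboundary {zero}  f = Lift (c ⊔ lsuc ℓ) (∀ x → f x A.≈ A.0#)
  IsCoboundary {suc n} f = Σ (Cochain n) λ h → ∀ x → f x A.≈ δ (Cochain.fun h) x

  Cohomologous : ∀ {n} (f g : Vector Carrier (suc n) → A.Carrier) → Set (c ⊔ lsuc ℓ)
  Cohomologous f g = IsCoboundary (λ x → f x A.- g x)

  -- (f ⌣ g)(x₀,…,xₘ₊ₙ) = f(x₀,…,xₘ) g(xₘ,…,xₘ₊ₙ)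
  infixl 7 _⌣_
  _⌣_ : ∀ {m n} → (Vector Carrier (suc m) → A.Carrier) →
        (Vector Carrier (suc n) → A.Carrier) →
        Vector Carrier (suc (m + n)) → A.Carrier
  _⌣_ {m} {n} f g x = f (λ k → x (k ↑ˡ n)) A.* g (λ k → x (cast (ℕ.+-suc m n) (m ↑ʳ k)))

  InR : Cocycle 1 → Set (c ⊔ lsuc ℓ)
  InR α = ∀ (β : Cocycle 1) → IsCoboundary (Cocycle.fun α ⌣ Cocycle.fun β)

-- The corestriction of homogeneous cochains.  Write c̄ = from j for the chosen
-- representative of the j-th coset c ∈ U\G; then
--   (cor f)(x₀,…,xₙ) = Σ_c f(…, c̄ xₖ (representative of c xₖ)⁻¹, …).
module _ (A : CommutativeRing 0ℓ 0ℓ) {G : TopologicalGroup c ℓ} (U : OpenSubgroup G) where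
  private module A = CommutativeRing A
  open TopologicalGroup G
  open OpenSubgroup U
  open Sums A.+-commutativeMonoid using (sum)

  corestriction : ∀ {k n} → HasIndex subgroup k →
                  (Vector (Σ Carrier Mem) (suc n) → A.Carrier) →
                  Vector Carrier (suc n) → A.Carrier
  corestriction index f x = sum λ j → f λ k → transfer (from j ∙ x k)
    where
    open Inverse index
    transfer : Carrier → Σ Carrier Mem
    transfer g = g // from (to g)
               , Setoid.sym (rightCosets subgroup) {from (to g)} {g} (strictlyInverseʳ g)

KijimaNishi : ℕ → TopologicalGroup c ℓ → Set (c ⊔ lsuc ℓ)
KijimaNishi p G =
  (U : OpenSubgroup G) → let module U = OpenSubgroup U in
  Normal (TopologicalGroup.group G) U.subgroup →
  (index : HasIndex U.subgroup p) →
  let module HU = Cohomology (𝔽 p) (openSubgroup U)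
      module HG = Cohomology (𝔽 p) G
  in
  (α : HG.Cocycle 1) → HG.InR α →
  Σ (HU.Cocycle 1) λ β → HU.InR β ×
    HG.Cohomologous (corestriction (𝔽 p) U index (HU.Cocycle.fun β)) (HG.Cocycle.fun α)

------------------------------------------------------------------------
-- Inverse limits of discrete groups

record InverseSystem a r c ℓ : Set (lsuc (a ⊔ r ⊔ c ⊔ ℓ)) where
  infix 4 _≼_
  field
    Index   : Set a
    _≼_     : Rel Index r
    ≼-refl  : Reflexive _≼_
    ≼-trans : Transitive _≼_
    obj     : Index → Group c ℓ
  module obj j = Group (obj j)
  field
    hom       : ∀ {j k} → j ≼ k → obj.Carrier k → obj.Carrier j
    hom-homo  : ∀ {j k} (e : j ≼ k) →
                GroupMorphisms.IsGroupHomomorphism (obj.rawGroup k) (obj.rawGroup j) (hom e)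
    hom-refl  : ∀ {j} (e : j ≼ j) x → obj._≈_ j (hom e x) x
    hom-trans : ∀ {j k l} (e : j ≼ k) (e′ : k ≼ l) (e″ : j ≼ l) x →
                obj._≈_ j (hom e (hom e′ x)) (hom e″ x)

module _ (S : InverseSystem a r c ℓ) where
  open InverseSystem S

  module homo {j k} (e : j ≼ k) = GroupMorphisms.IsGroupHomomorphism (hom-homo e)

  Thread : Set (a ⊔ r ⊔ c ⊔ ℓ)
  Thread = Σ (∀ j → obj.Carrier j) λ x → ∀ {j k} (e : j ≼ k) → obj._≈_ j (hom e (x k)) (x j)

  limGroup : Group (a ⊔ r ⊔ c ⊔ ℓ) (a ⊔ ℓ)
  limGroup = record
    { Carrier = Thread
    ; _≈_ = λ x y → ∀ j → obj._≈_ j (proj₁ x j) (proj₁ y j)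
    ; _∙_ = λ (x , x≈) (y , y≈) → (λ j → obj._∙_ j (x j) (y j)) , λ {j} {k} e →
        obj.trans j (homo.homo e (x k) (y k)) (obj.∙-cong j (x≈ e) (y≈ e))
    ; ε = obj.ε , homo.ε-homo
    ; _⁻¹ = λ (x , x≈) → (λ j → obj._⁻¹ j (x j)) , λ {j} {k} e →
        obj.trans j (homo.⁻¹-homo e (x k)) (obj.⁻¹-cong j (x≈ e))
    ; isGroup = record
      { isMonoid = record
        { isSemigroup = record
          { isMagma = record
            { isEquivalence = record
              { refl = λ j → obj.refl j
              ; sym = λ e j → obj.sym j (e j)
              ; trans = λ e f j → obj.trans j (e j) (f j)
              }
            ; ∙-cong = λ e f j → obj.∙-cong j (e j) (f j)
            }
          ; assoc = λ _ _ _ j → obj.assoc j _ _ _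
          }
        ; identity = (λ _ j → obj.identityˡ j _) , (λ _ j → obj.identityʳ j _)
        }
      ; inverse = (λ _ j → obj.inverseˡ j _) , (λ _ j → obj.inverseʳ j _)
      ; ⁻¹-cong = λ e j → obj.⁻¹-cong j (e j)
      }
    }

  -- the threads agreeing with x at the indices in js
  Cylinder : List Index → Thread → Pred Thread (a ⊔ ℓ)
  Cylinder js x y = All (λ j → obj._≈_ j (proj₁ x j) (proj₁ y j)) js

  IsOpenLim : Pred (Pred Thread (a ⊔ ℓ)) (a ⊔ r ⊔ c ⊔ ℓ)
  IsOpenLim V = ∀ x → V x → ∃[ js ] Cylinder js x ⊆ V

  cylinder-open : ∀ js x → IsOpenLim (Cylinder js x)
  cylinder-open js x y x~y = js , λ y~z →
    All.zipWith (λ {j} (e , f) → obj.trans j e f) (x~y , y~z)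

  cylinder-self : ∀ js x → Cylinder js x x
  cylinder-self js x = All.universal (λ j → obj.refl j) js

  -- The topology is induced by the product topology on the product of the
  -- discrete groups obj j.
  Lim : TopologicalGroup (a ⊔ r ⊔ c ⊔ ℓ) (a ⊔ ℓ)
  Lim = record
    { group = limGroup
    ; IsOpen = IsOpenLim
    ; open-resp = λ oV {x} {y} e v → let (js , h) = oV x v in
        h {y} (All.universal (λ j → e j) js)
    ; open-⊤ = λ _ _ → [] , λ _ → lift tt
    ; open-∩ = λ oV oW x (v , w) →
        let (js , h) = oV x v
            (ks , h′) = oW x w
        in js ++ ks , λ {y} e → h {y} (All.++⁻ˡ js e) , h′ {y} (All.++⁻ʳ js e)
    ; open-⋃ = λ loc x v →
        let (W , oW , w , W⊆V) = loc x v
            (js , h) = oW x w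
        in js , λ {y} e → W⊆V {y} (h {y} e)
    ; ∙-cont = λ x y oV v → let (js , h) = oV _ v in
        Cylinder js x , Cylinder js y , cylinder-open js x , cylinder-open js y ,
        cylinder-self js x , cylinder-self js y ,
        λ {x′} {y′} e f → h {Group._∙_ limGroup x′ y′}
          (All.zipWith (λ {j} (e , f) → obj.∙-cong j e f) (e , f))
    ; ⁻¹-cont = λ x oV v → let (js , h) = oV _ v in
        Cylinder js x , cylinder-open js x , cylinder-self js x ,
        λ {x′} e → h {Group._⁻¹ limGroup x′} (All.map (λ {j} → obj.⁻¹-cong j) e)
    }

------------------------------------------------------------------------
-- Pro-p groups

-- The last two fields say that to and its inverse are continuous, the inverse
-- being expressed by openness of to.
record _≅_ (G : TopologicalGroup c ℓ) (H : TopologicalGroup c′ ℓ′) :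
           Set (c ⊔ lsuc ℓ ⊔ c′ ⊔ lsuc ℓ′) where
  private
    module G = TopologicalGroup G
    module H = TopologicalGroup H
  field
    to         : G.Carrier → H.Carrier
    isIso      : GroupMorphisms.IsGroupIsomorphism G.rawGroup H.rawGroup to
    continuous : ∀ x {V} → H.IsOpen V → V (to x) →
                 ∃[ W ] G.IsOpen W × W x × (∀ {y} → W y → V (to y))
    open-map   : ∀ x {W} → G.IsOpen W → W x →
                 ∃[ V ] H.IsOpen V × V (to x) × (∀ {y} → V (to y) → W y)

-- A pro-p group is a topological group isomorphic to the inverse limit of a
-- directed system of finite p-groups.  The universe levels of the system are
-- those of the system of quotients of the group by its open normal subgroups.
record ProPGroup p c ℓ : Set (lsuc (c ⊔ lsuc ℓ)) where
  field
    topologicalGroup : TopologicalGroup c ℓ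
    system           : InverseSystem (c ⊔ lsuc ℓ) (c ⊔ ℓ) c ℓ
  open InverseSystem system
  field
    nonempty   : Index
    directed   : ∀ j k → ∃[ l ] j ≼ l × k ≼ l
    p-groups   : ∀ j → ∃[ n ] Inverse (obj.setoid j) (≡.setoid (Fin (p ^ n)))
    isLimit    : topologicalGroup ≅ Lim system
  open TopologicalGroup topologicalGroup public

------------------------------------------------------------------------
-- Free products of abstract groups, as words modulo the congruence generated
-- by the relations of the factors

module FreeProduct {I : Set i} (𝒢 : I → Group c ℓ) where
  private module 𝒢 j = Group (𝒢 j)

  Word : Set (i ⊔ c)
  Word = List (Σ I 𝒢.Carrier)

  infix 4 _∼_
  data _∼_ : Rel Word (i ⊔ c ⊔ ℓ) where
    ∼-refl  : ∀ {u} → u ∼ u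
    ∼-sym   : ∀ {u v} → u ∼ v → v ∼ u
    ∼-trans : ∀ {u v w} → u ∼ v → v ∼ w → u ∼ w
    ++-cong : ∀ {u u′ v v′} → u ∼ u′ → v ∼ v′ → u ++ v ∼ u′ ++ v′
    letter  : ∀ j {x y} → 𝒢._≈_ j x y → [ j , x ] ∼ [ j , y ]
    unit    : ∀ j → [ j , 𝒢.ε j ] ∼ []
    mult    : ∀ j x y → (j , x) ∷ (j , y) ∷ [] ∼ [ j , 𝒢._∙_ j x y ]

  invLetter : Σ I 𝒢.Carrier → Σ I 𝒢.Carrier
  invLetter (j , x) = j , 𝒢._⁻¹ j x

  inv : Word → Word
  inv []      = []
  inv (l ∷ w) = inv w ++ [ invLetter l ]

  ≡⇒∼ : ∀ {u v} → u ≡ v → u ∼ v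
  ≡⇒∼ ≡.refl = ∼-refl

  inv-++ : ∀ u v → inv (u ++ v) ≡ inv v ++ inv u
  inv-++ []      v = ≡.sym (List.++-identityʳ (inv v))
  inv-++ (l ∷ u) v = ≡.trans (≡.cong (_++ [ invLetter l ]) (inv-++ u v))
                             (List.++-assoc (inv v) (inv u) _)

  inv-cong : ∀ {u v} → u ∼ v → inv u ∼ inv v
  inv-cong ∼-refl = ∼-refl
  inv-cong (∼-sym e) = ∼-sym (inv-cong e)
  inv-cong (∼-trans e f) = ∼-trans (inv-cong e) (inv-cong f)
  inv-cong (++-cong {u} {u′} {v} {v′} e f) =
    ∼-trans (≡⇒∼ (inv-++ u v))
      (∼-trans (++-cong (inv-cong f) (inv-cong e)) (≡⇒∼ (≡.sym (inv-++ u′ v′))))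
  inv-cong (letter j e) = letter j (𝒢.⁻¹-cong j e)
  inv-cong (unit j) = ∼-trans (letter j (GroupProperties.ε⁻¹≈ε (𝒢 j))) (unit j)
  inv-cong (mult j x y) =
    ∼-trans (mult j _ _)
      (letter j (𝒢.sym j (GroupProperties.⁻¹-anti-homo-∙ (𝒢 j) x y)))

  inverseʳ : ∀ w → w ++ inv w ∼ []
  inverseʳ [] = ∼-refl
  inverseʳ ((j , x) ∷ w) =
    ∼-trans (≡⇒∼ (≡.cong ((j , x) ∷_) (≡.sym (List.++-assoc w (inv w) _))))
    (∼-trans (++-cong {u = [ j , x ]} ∼-refl (++-cong (inverseʳ w) ∼-refl))
    (∼-trans (mult j x _)
    (∼-trans (letter j (𝒢.inverseʳ j x)) (unit j))))

  inverseˡ : ∀ w → inv w ++ w ∼ []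
  inverseˡ [] = ∼-refl
  inverseˡ ((j , x) ∷ w) =
    ∼-trans (≡⇒∼ (List.++-assoc (inv w) _ _))
    (∼-trans (++-cong {u = inv w} ∼-refl
      (++-cong {v = w} (∼-trans (mult j _ x) (∼-trans (letter j (𝒢.inverseˡ j x)) (unit j)))
               ∼-refl))
    (inverseˡ w))

  freeProduct : Group (i ⊔ c) (i ⊔ c ⊔ ℓ)
  freeProduct = record
    { Carrier = Word
    ; _≈_ = _∼_
    ; _∙_ = _++_
    ; ε = []
    ; _⁻¹ = inv
    ; isGroup = record
      { isMonoid = record
        { isSemigroup = record
          { isMagma = record
            { isEquivalence = record { refl = ∼-refl ; sym = ∼-sym ; trans = ∼-trans }
            ; ∙-cong = ++-cong
            }
          ; assoc = λ u v w → ≡⇒∼ (List.++-assoc u v w)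
          }
        ; identity = (λ _ → ∼-refl) , (λ u → ≡⇒∼ (List.++-identityʳ u))
        }
      ; inverse = inverseˡ , inverseʳ
      ; ⁻¹-cong = inv-cong
      }
    }

  ι : ∀ j → 𝒢.Carrier j → Word
  ι j x = [ j , x ]

------------------------------------------------------------------------
-- Free pro-p products

module _ (p : ℕ) {I : Set i} (𝒢 : I → ProPGroup p c ℓ) where
  private module 𝒢 j = ProPGroup (𝒢 j)
  open FreeProduct 𝒢.group

  record AdmissibleSubgroup : Set (i ⊔ c ⊔ lsuc ℓ) where
    field
      subgroup     : Subgroup freeProduct ℓ
    open Subgroup subgroup public
    field
      normal       : Normal freeProduct subgroup
      p-power      : ∃[ n ] HasIndex subgroup (p ^ n)
      factors-open : ∀ j → 𝒢.IsOpen j (λ x → Mem (ι j x))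
      almost-all   : ∃[ js ] ∀ j → j ∉ js → ∀ x → Mem (ι j x)

  quotients : InverseSystem (i ⊔ c ⊔ lsuc ℓ) (i ⊔ c ⊔ ℓ) (i ⊔ c) ℓ
  quotients = record
    { Index = AdmissibleSubgroup
    ; _≼_ = λ M N → ∀ {w} → Mem N w → Mem M w
    ; ≼-refl = id
    ; ≼-trans = λ e f n → e (f n)
    ; obj = obj
    ; hom = λ _ → id
    ; hom-homo = λ {M} {N} e → record
      { isMonoidHomomorphism = record
        { isMagmaHomomorphism = record
          { isRelHomomorphism = record { cong = e }
          ; homo = λ u v → Group.refl (obj M) {u ++ v}
          }
        ; ε-homo = Group.refl (obj M) {[]}
        }
      ; ⁻¹-homo = λ u → Group.refl (obj M) {Group._⁻¹ freeProduct u}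
      }
    ; hom-refl = λ {M} _ x → Group.refl (obj M) {x}
    ; hom-trans = λ {M} _ _ _ x → Group.refl (obj M) {x}
    }
    where
    open AdmissibleSubgroup
    obj : AdmissibleSubgroup → Group (i ⊔ c) ℓ
    obj N = quotient (subgroup N) (normal N)

  freeProPProduct : TopologicalGroup (i ⊔ c ⊔ lsuc ℓ) (i ⊔ c ⊔ lsuc ℓ)
  freeProPProduct = Lim quotients

{-# OPTIONS --safe #-}
-- Continuous homomorphisms from G to a finite p-group are the families of continuous
-- homomorphisms on the factors that are trivial on almost all of them, so a lifting problem for
-- such homomorphisms can be solved factor by factor.  Both cup products and open subgroups fit in:
-- α ⌣ β = 0 exactly when (α , β) lifts to the Heisenberg group, and by Shapiro's lemma
-- homomorphisms U → P correspond to homomorphisms G → P ≀ G/U above the projection to G/U.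
--
-- If all factors have the property, α in the radical of G and U are given, then a preimage of α
-- under the corestriction is a homomorphism G → 𝔽ₚ ≀ G/U, and is chosen on each factor Gᵢ: if
-- Gᵢ ⊆ U, it is α in one coordinate of the base group and 0 in the others; otherwise Gᵢ maps onto
-- G/U, and it comes from the property of Gᵢ for Gᵢ ∩ U.  Conversely α and U for one factor are
-- extended to G trivially on the other factors, and the preimage for G is restricted to the factor.

module Submission where

open import Defs
open import Level using (Level; _⊔_; 0ℓ; Lift; lift; lower) renaming (suc to lsuc)
open import Algebra.Bundles using (Group; CommutativeRing)
import Algebra.Construct.DirectProduct as DirectProduct
import Algebra.Morphism.GroupMonomorphism as GroupMonomorphism
import Algebra.Properties.CommutativeMonoid.Sum as Sums
import Algebra.Properties.Group as GroupProperties
import Algebra.Properties.Ring as RingProperties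
open import Algebra.Structures using (IsGroup)
open import Axiom.ExcludedMiddle using (ExcludedMiddle)
open import Data.Empty using (⊥-elim)
open import Data.Fin.Base
  using (Fin; zero; suc; toℕ; fromℕ<; punchIn; combine; remQuot; funToFin; finToFun)
import Data.Fin.Permutation as Permutation
import Data.Fin.Properties as Fin
open import Data.Integer.Base as ℤ using (ℤ)
import Data.Integer.DivMod as ℤ
open import Data.Integer.Divisibility.Signed as ℤ∣ using (divides)
import Data.Integer.Properties as ℤ
import Data.Integer.Tactic.RingSolver as ℤSolver
open import Data.Maybe.Base using (nothing)
open import Data.Nat.Base as ℕ using (ℕ; zero; suc; _^_; NonZero)
open import Data.Nat.Divisibility as ℕ∣ using (_∣_)
open import Data.Nat.Primality as Prime using (Prime)
import Data.Nat.Properties as ℕ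
open import Data.Product using (Σ; _×_; _,_; proj₁; proj₂; ∃-syntax; uncurry)
open import Data.Product.Relation.Binary.Pointwise.NonDependent using (×-setoid)
open import Data.Sum using (_⊎_; inj₁; inj₂)
open import Data.Unit.Base using (⊤; tt)
open import Data.Vec.Functional using (Vector; removeAt)
open import Function.Base using (_∘_; id)
open import Function.Bundles using (Inverse; _⇔_; mk⇔; mk⤖)
open import Function.Properties.Bijection using (⤖⇒↔)
open import Relation.Binary.Bundles using (Setoid)
open import Relation.Binary.PropositionalEquality as ≡ using (_≡_; _≢_)
import Relation.Binary.Reasoning.Setoid as SetoidReasoning
open import Relation.Nullary using (¬_; Dec; yes; no)
open import Relation.Unary using (Pred)
open import Tactic.RingSolver using (solve-∀)
open import Tactic.RingSolver.Core.AlmostCommutativeRing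
  using (AlmostCommutativeRing; fromCommutativeRing)

private
  variable
    i c s ℓ c′ ℓ′ ℓ₁ ℓ₂ : Level

-- The delicate point is that the preimage must lie in the radical of `U`. No description of `U` as
-- a free product, in the style of Kurosh's subgroup theorem, enters: `IsWreathRadical` restates the
-- condition over the whole group, as a lifting problem from two wreath products of `additive A` to
-- the wreath product of `heisenberg A`, and this can be solved on each factor. Gluing requires that
-- almost all of the given homomorphisms are trivial. Local solutions are therefore chosen trivial
-- wherever their data are, which is the reason for the last component of `TransferPreimage` and for
-- the case distinction before `lift-factorwise`. Since `p` is prime, a factor has trivial or full
-- image in the group of cosets, and no third case occurs. Shapiro's correspondence depends on coset
-- representatives and holds only up to conjugation by the base group. The conjugating terms cancel
-- in sums over the cosets, and `twist` removes them from lifts.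

prime-power-divisor : ∀ {p} → Prime p → ∀ n {d} → d ∣ p ^ n → ∃[ k ] d ≡ p ^ k
prime-power-divisor pp zero d∣1 = 0 , ℕ∣.∣1⇒≡1 d∣1
prime-power-divisor {p} pp (suc n) {d} (ℕ∣.divides e eq)
  with Prime.euclidsLemma e d pp (ℕ∣.divides (p ^ n) (≡.trans (≡.sym eq) (ℕ.*-comm p (p ^ n))))
... | inj₁ (ℕ∣.divides e′ ≡.refl) = prime-power-divisor pp n (ℕ∣.divides e′
        (ℕ.*-cancelˡ-≡ _ _ p {{Prime.prime⇒nonZero pp}}
        (≡.trans eq (≡.trans (≡.cong (ℕ._* d) (ℕ.*-comm e′ p)) (ℕ.*-assoc p e′ d)))))
... | inj₂ (ℕ∣.divides d′ ≡.refl)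
  with k , ≡.refl ← prime-power-divisor pp n {d′} (ℕ∣.divides e
        (ℕ.*-cancelˡ-≡ _ _ p {{Prime.prime⇒nonZero pp}}
        (≡.trans eq (≡.trans (≡.sym (ℕ.*-assoc e d′ p)) (ℕ.*-comm (e ℕ.* d′) p)))))
  = suc k , ℕ.*-comm (p ^ k) p

-- Homomorphisms and Lagrange's theorem

record Homomorphism (A : Group c ℓ₁) (B : Group c′ ℓ₂) : Set (c ⊔ c′ ⊔ ℓ₁ ⊔ ℓ₂) where
  private
    module A = Group A
    module B = Group B
  field
    fun  : A.Carrier → B.Carrier
    cong : ∀ {x y} → x A.≈ y → fun x B.≈ fun y
    homo : ∀ x y → fun (x A.∙ y) B.≈ fun x B.∙ fun y

  ε-homo : fun A.ε B.≈ B.ε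
  ε-homo = GroupProperties.identityʳ-unique B _ _
    (B.trans (B.sym (homo A.ε A.ε)) (cong (A.identityˡ A.ε)))

  ⁻¹-homo : ∀ x → fun (x A.⁻¹) B.≈ fun x B.⁻¹
  ⁻¹-homo x = GroupProperties.inverseʳ-unique B _ _
    (B.trans (B.sym (homo x (x A.⁻¹))) (B.trans (cong (A.inverseʳ x)) ε-homo))

  //-homo : ∀ x y → fun (x A.∙ y A.⁻¹) B.≈ fun x B.∙ fun y B.⁻¹
  //-homo x y = B.trans (homo x (y A.⁻¹)) (B.∙-congˡ (⁻¹-homo y))

  //≈ε⇒≈ : ∀ {x y} → fun (x A.∙ y A.⁻¹) B.≈ B.ε → fun x B.≈ fun y
  //≈ε⇒≈ {x} {y} e = GroupProperties.x∙y⁻¹≈ε⇒x≈y B _ _ (B.trans (B.sym (//-homo x y)) e)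

  ≈⇒//≈ε : ∀ {x y} → fun x B.≈ fun y → fun (x A.∙ y A.⁻¹) B.≈ B.ε
  ≈⇒//≈ε {x} {y} e = B.trans (//-homo x y) (GroupProperties.x≈y⇒x∙y⁻¹≈ε B e)

-- The level `s` is free because open and admissible subgroups have membership at a prescribed
-- level, which equality in the target need not have.
kernel : ∀ {A : Group c ℓ₁} {B : Group c′ ℓ₂} s → Homomorphism A B → Subgroup A (ℓ₂ ⊔ s)
kernel {A = A} {B} s f = record
  { Mem       = λ x → Lift s (fun x B.≈ B.ε)
  ; resp      = λ e (lift m) → lift (B.trans (B.sym (cong e)) m)
  ; ε-mem     = lift ε-homo
  ; ∙-closed  = λ {x} {y} (lift m) (lift n) →
      lift (B.trans (homo x y) (B.trans (B.∙-cong m n) (B.identityˡ _)))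
  ; ⁻¹-closed = λ {x} (lift m) →
      lift (B.trans (⁻¹-homo x) (B.trans (B.⁻¹-cong m) (GroupProperties.ε⁻¹≈ε B)))
  }
  where
  open Homomorphism f
  module B = Group B

kernel-normal : ∀ {A : Group c ℓ₁} {B : Group c′ ℓ₂} s (f : Homomorphism A B) →
                Normal A (kernel s f)
kernel-normal {A = A} {B} s f g {x} (lift m) = lift (begin
  fun (g A.∙ x A.∙ g A.⁻¹)         ≈⟨ homo _ _ ⟩
  fun (g A.∙ x) B.∙ fun (g A.⁻¹)   ≈⟨ B.∙-congʳ (homo g x) ⟩
  fun g B.∙ fun x B.∙ fun (g A.⁻¹) ≈⟨ B.∙-congʳ (B.trans (B.∙-congˡ m) (B.identityʳ _)) ⟩
  fun g B.∙ fun (g A.⁻¹)           ≈⟨ homo g _ ⟨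
  fun (g A.∙ g A.⁻¹)               ≈⟨ cong (A.inverseʳ g) ⟩
  fun A.ε                          ≈⟨ ε-homo ⟩
  B.ε                              ∎)
  where
  open Homomorphism f
  module A = Group A
  module B = Group B
  open SetoidReasoning B.setoid

imageSubgroup : ∀ {A : Group c ℓ₁} {B : Group c′ ℓ₂} → Homomorphism A B → Subgroup B (c ⊔ ℓ₂)
imageSubgroup {A = A} {B} f = record
  { Mem       = λ y → ∃[ x ] fun x B.≈ y
  ; resp      = λ e (x , m) → x , B.trans m e
  ; ε-mem     = A.ε , ε-homo
  ; ∙-closed  = λ (x , m) (y , n) → x A.∙ y , B.trans (homo x y) (B.∙-cong m n)
  ; ⁻¹-closed = λ (x , m) → x A.⁻¹ , B.trans (⁻¹-homo x) (B.⁻¹-cong m)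
  }
  where
  open Homomorphism f
  module A = Group A
  module B = Group B

-- Counting cosets with excluded middle

module Classical (em : ∀ a → ExcludedMiddle a) where

  module _ (S : Setoid c ℓ) where
    open Setoid S

    private
      -- Equality in `S` is not assumed decidable, so excluded middle tells whether a value has
      -- already occurred. Repetitions have to go because `Inverse` demands a bijection.
      distinct : ∀ n (g : Fin n → Carrier) → ∃[ m ] Σ (Fin m → Carrier) λ h →
                 (∀ {i j} → h i ≈ h j → i ≡ j) × (∀ i → ∃[ j ] h j ≈ g i)
      distinct zero g = 0 , g , (λ { {()} }) , λ ()
      distinct (suc n) g with distinct n (g ∘ suc)
      ... | m , h , inj , sur with em _ {∃[ j ] h j ≈ g zero}
      ... | yes e = m , h , inj , λ { zero → e ; (suc i) → sur i }
      ... | no ¬e = suc m , h′ , (λ {i} {j} → inj′ {i} {j}) , λ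
        { zero → zero , refl ; (suc i) → suc (proj₁ (sur i)) , proj₂ (sur i) }
        where
        h′ : Fin (suc m) → Carrier
        h′ zero = g zero
        h′ (suc i) = h i
        inj′ : ∀ {i j} → h′ i ≈ h′ j → i ≡ j
        inj′ {zero}  {zero}  e = ≡.refl
        inj′ {zero}  {suc j} e = ⊥-elim (¬e (j , sym e))
        inj′ {suc i} {zero}  e = ⊥-elim (¬e (i , e))
        inj′ {suc i} {suc j} e = ≡.cong suc (inj e)

    surjection⇒finite : ∀ n (g : Fin n → Carrier) → (∀ x → ∃[ i ] g i ≈ x) →
                        ∃[ m ] Inverse S (≡.setoid (Fin m))
    surjection⇒finite n g surj with distinct n g
    ... | m , h , inj , sur = m , record
      { to = to
      ; from = h
      ; to-cong = λ e → inj (trans (h-to _) (trans e (sym (h-to _))))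
      ; from-cong = λ { ≡.refl → refl }
      ; inverse = (λ e → inj (trans (h-to _) e)) , λ { ≡.refl → h-to _ }
      }
      where
      to : Carrier → Fin m
      to x = proj₁ (sur (proj₁ (surj x)))
      h-to : ∀ x → h (to x) ≈ x
      h-to x = trans (proj₂ (sur (proj₁ (surj x)))) (proj₂ (surj x))

  -- `K` is the kernel in whatever form and level the caller has it, for instance as an intersection
  -- of two subgroups.
  module _ {A : Group c ℓ₁} {B : Group c′ ℓ₂} (f : Homomorphism A B)
           {q} (card : Inverse (Group.setoid B) (≡.setoid (Fin q)))
           (K : Subgroup A s)
           (K⇒ker : ∀ {x} → Subgroup.Mem K x → Group._≈_ B (Homomorphism.fun f x) (Group.ε B))
           (ker⇒K : ∀ {x} → Group._≈_ B (Homomorphism.fun f x) (Group.ε B) → Subgroup.Mem K x)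
    where
    private
      module A = Group A
      module B = Group B
      module card = Inverse card
      open Homomorphism f
      Im : Subgroup B _
      Im = imageSubgroup f
      module Q = Setoid (rightCosets K)
      module R = Setoid (rightCosets Im)

      pick : ∀ {y} → Dec (∃[ x ] fun x B.≈ y) → A.Carrier
      pick (yes (x , _)) = x
      -- The default is harmless: `pick` has to be correct only at points of the image.
      pick (no _)        = A.ε

      pick-correct : ∀ {y} (d : Dec (∃[ x ] fun x B.≈ y)) x → fun x B.≈ y → pick d Q.≈ x
      pick-correct (yes (_ , e)) x e′ = ker⇒K (≈⇒//≈ε (B.trans e (B.sym e′)))
      pick-correct (no ¬e)       x e′ = ⊥-elim (¬e (x , e′))

    index-kernel : ∃[ m ] HasIndex K m
    index-kernel = surjection⇒finite (rightCosets K) q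
      (λ i → pick (em _ {∃[ x ] fun x B.≈ card.from i}))
      λ x → card.to (fun x) , pick-correct (em _) x (B.sym (card.strictlyInverseʳ (fun x)))

    index-image : ∃[ k ] HasIndex Im k
    index-image = surjection⇒finite (rightCosets Im) q card.from λ y →
      card.to y , A.ε , B.trans ε-homo (B.sym (B.trans
        (B.∙-congʳ (card.strictlyInverseʳ y)) (B.inverseʳ y)))

    -- Every element of `B` is uniquely an element of the image times the chosen representative of
    -- its right coset, and elements of the image correspond to cosets of `K`. The resulting
    -- bijection is `pair`.
    lagrange : q ≡ proj₁ index-kernel ℕ.* proj₁ index-image
    lagrange = ≡.sym (Permutation.↔⇒≡ (⤖⇒↔ (mk⤖ {to = to} (injective , surjective))))
      where
      m = proj₁ index-kernel
      k = proj₁ index-image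
      module κ = Inverse (proj₂ index-kernel)
      module ρ = Inverse (proj₂ index-image)

      pair : Fin m → Fin k → B.Carrier
      pair i j = fun (κ.from i) B.∙ ρ.from j

      to′ : Fin m × Fin k → Fin q
      to′ (i , j) = card.to (pair i j)

      to : Fin (m ℕ.* k) → Fin q
      to = to′ ∘ remQuot {m} k

      pair-injective : ∀ i j i′ j′ → pair i j B.≈ pair i′ j′ → (i , j) ≡ (i′ , j′)
      pair-injective i j i′ j′ e = ≡.cong₂ _,_ i≡ j≡
        where
        open SetoidReasoning B.setoid
        module BP = GroupProperties B
        x = κ.from i
        x′ = κ.from i′
        j≡ : j ≡ j′
        j≡ = ≡.trans (≡.sym (ρ.strictlyInverseˡ j)) (≡.trans (ρ.to-cong (x A.⁻¹ A.∙ x′ , (begin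
          fun (x A.⁻¹ A.∙ x′)                      ≈⟨ homo _ _ ⟩
          fun (x A.⁻¹) B.∙ fun x′                  ≈⟨ B.∙-congʳ (⁻¹-homo x) ⟩
          fun x B.⁻¹ B.∙ fun x′                    ≈⟨ B.∙-congˡ (BP.x≈z//y _ _ _ (B.sym e)) ⟩
          fun x B.⁻¹ B.∙ (pair i j B.∙ ρ.from j′ B.⁻¹) ≈⟨ B.assoc _ _ _ ⟨
          fun x B.⁻¹ B.∙ pair i j B.∙ ρ.from j′ B.⁻¹   ≈⟨ B.∙-congʳ (BP.\\-leftDividesʳ (fun x) (ρ.from j)) ⟩
          ρ.from j B.∙ ρ.from j′ B.⁻¹              ∎))) (ρ.strictlyInverseˡ j′))
        i≡ : i ≡ i′
        i≡ = ≡.trans (≡.sym (κ.strictlyInverseˡ i)) (≡.trans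
          (κ.to-cong (ker⇒K (≈⇒//≈ε (BP.∙-cancelʳ (ρ.from j) _ _
            (B.trans e (B.∙-congˡ (B.reflexive (≡.cong ρ.from (≡.sym j≡)))))))))
          (κ.strictlyInverseˡ i′))

      injective : ∀ {u v} → to u ≡ to v → u ≡ v
      injective {u} {v} e = ≡.trans (≡.sym (Fin.combine-remQuot {m} k u)) (≡.trans
        (≡.cong (uncurry combine) (pair-injective _ _ _ _
          (B.trans (B.sym (card.strictlyInverseʳ _))
            (B.trans (card.from-cong e) (card.strictlyInverseʳ _)))))
        (Fin.combine-remQuot {m} k v))

      surjective : ∀ y → ∃[ u ] (∀ {z} → z ≡ u → to z ≡ y)
      surjective y = combine i₀ j₀ , λ { ≡.refl →
        ≡.trans (≡.cong to′ (Fin.remQuot-combine i₀ j₀))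
          (≡.trans (card.to-cong hits) (card.strictlyInverseˡ y)) }
        where
        open SetoidReasoning B.setoid
        z = card.from y
        j₀ = ρ.to z
        z/j : Subgroup.Mem Im (z B.∙ ρ.from j₀ B.⁻¹)
        z/j = R.sym {ρ.from j₀} {z} (ρ.strictlyInverseʳ z)
        i₀ = κ.to (proj₁ z/j)
        hits : pair i₀ j₀ B.≈ z
        hits = begin
          fun (κ.from i₀) B.∙ ρ.from j₀         ≈⟨ B.∙-congʳ (//≈ε⇒≈ (K⇒ker (κ.strictlyInverseʳ (proj₁ z/j)))) ⟩
          fun (proj₁ z/j) B.∙ ρ.from j₀        ≈⟨ B.∙-congʳ (proj₂ z/j) ⟩
          z B.∙ ρ.from j₀ B.⁻¹ B.∙ ρ.from j₀    ≈⟨ GroupProperties.//-rightDividesˡ B (ρ.from j₀) z ⟩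
          z                                   ∎

-- Wreath products and Heisenberg groups

Finite : Setoid c ℓ → ℕ → Set (c ⊔ ℓ)
Finite S n = Inverse S (≡.setoid (Fin n))

mkFinite : ∀ {S : Setoid c ℓ} {n} → let open Setoid S in
           (to : Carrier → Fin n) (from : Fin n → Carrier) →
           (∀ {x y} → x ≈ y → to x ≡ to y) →
           (∀ i → to (from i) ≡ i) → (∀ x → from (to x) ≈ x) → Finite S n
mkFinite {S = S} to from to-cong to-from from-to = record
  { to = to
  ; from = from
  ; to-cong = to-cong
  ; from-cong = λ { ≡.refl → refl }
  ; inverse = (λ {i} e → ≡.trans (to-cong e) (to-from i)) , λ { {x} ≡.refl → from-to x }
  }
  where open Setoid S

×-finite : ∀ {S : Setoid c ℓ} {T : Setoid c′ ℓ′} {m n} →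
           Finite S m → Finite T n → Finite (×-setoid S T) (m ℕ.* n)
×-finite {m = m} {n} card card′ = mkFinite
  (λ (x , y) → combine (S.to x) (T.to y))
  (λ i → S.from (proj₁ (remQuot {m} n i)) , T.from (proj₂ (remQuot {m} n i)))
  (λ (e , e′) → ≡.cong₂ combine (S.to-cong e) (T.to-cong e′))
  (λ i → ≡.trans (≡.cong₂ combine (S.strictlyInverseˡ _) (T.strictlyInverseˡ _))
                 (Fin.combine-remQuot {m} n i))
  λ (x , y) →
    S.Eq₁.trans (S.from-cong (≡.cong proj₁ (Fin.remQuot-combine (S.to x) (T.to y)))) (S.strictlyInverseʳ x) ,
    T.Eq₁.trans (T.from-cong (≡.cong proj₂ (Fin.remQuot-combine (S.to x) (T.to y)))) (T.strictlyInverseʳ y)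
  where
  module S = Inverse card
  module T = Inverse card′

vectorSetoid : Setoid c ℓ → ℕ → Setoid c ℓ
vectorSetoid S k = record
  { Carrier = Fin k → Carrier
  ; _≈_ = λ f g → ∀ i → f i ≈ g i
  ; isEquivalence = record
    { refl = λ _ → refl ; sym = λ e i → sym (e i) ; trans = λ e e′ i → trans (e i) (e′ i) }
  }
  where open Setoid S

funToFin-cong : ∀ {k n} {f g : Fin k → Fin n} → (∀ i → f i ≡ g i) → funToFin f ≡ funToFin g
funToFin-cong {zero}  e = ≡.refl
funToFin-cong {suc k} e = ≡.cong₂ combine (e zero) (funToFin-cong (e ∘ suc))

vector-finite : ∀ {S : Setoid c ℓ} {n} k → Finite S n → Finite (vectorSetoid S k) (n ^ k)
vector-finite {S = S} {n} k card = mkFinite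
  (λ f → funToFin (to ∘ f))
  (λ i → from ∘ finToFun i)
  (λ e → funToFin-cong (λ i → to-cong (e i)))
  (λ i → ≡.trans (funToFin-cong {k} (λ j → strictlyInverseˡ (finToFun i j))) (Fin.funToFin-finToFin {k} {n} i))
  λ f j → Setoid.trans S (from-cong (Fin.finToFun-funToFin (to ∘ f) j)) (strictlyInverseʳ (f j))
  where open Inverse card

PPowerOrder : ℕ → Group c ℓ → Set (c ⊔ ℓ)
PPowerOrder p G = ∃[ n ] Finite (Group.setoid G) (p ^ n)

module Wreath {k} {_·_ : Fin k → Fin k → Fin k} {e inv}
              (C : IsGroup _≡_ _·_ e inv) where

  private module C = IsGroup C

  finGroup : Group 0ℓ 0ℓ
  finGroup = record { isGroup = C }

  -- P ≀ C for the regular action of C, which is written on the right.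
  wreath : Group c ℓ → Group c ℓ
  wreath P = record
    { Carrier = (Fin k → Carrier) × Fin k
    ; _≈_ = λ (f , c) (g , d) → (∀ s → f s ≈ g s) × c ≡ d
    ; _∙_ = λ (f , c) (g , d) → (λ s → f s ∙ g (s · c)) , c · d
    ; ε = (λ _ → ε) , e
    ; _⁻¹ = λ (f , c) → (λ s → f (s · inv c) ⁻¹) , inv c
    ; isGroup = record
      { isMonoid = record
        { isSemigroup = record
          { isMagma = record
            { isEquivalence = Setoid.isEquivalence (×-setoid (vectorSetoid setoid k) (≡.setoid (Fin k)))
            ; ∙-cong = λ { {x} {y} {u} {v} (f≈g , ≡.refl) (u≈v , ≡.refl) →
                (λ s → ∙-cong (f≈g s) (u≈v (s · proj₂ y))) , ≡.refl }
            }
          ; assoc = λ (f , c) (g , d) (h , b) →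
              (λ s → trans (assoc (f s) (g (s · c)) (h (s · (c · d))))
                (∙-congˡ (∙-congˡ (reflexive (≡.cong h (≡.sym (C.assoc s c d))))))) ,
              C.assoc c d b
          }
        ; identity =
            (λ (f , c) → (λ s → trans (identityˡ _) (reflexive (≡.cong f (C.identityʳ s)))) , C.identityˡ c) ,
            (λ (f , c) → (λ s → identityʳ _) , C.identityʳ c)
        }
      ; inverse =
          (λ (f , c) → (λ s → inverseˡ _) , C.inverseˡ c) ,
          (λ (f , c) → (λ s → trans (∙-congˡ (⁻¹-cong (reflexive (≡.cong f (begin
              (s · c) · inv c   ≡⟨ C.assoc s c (inv c) ⟩
              s · (c · inv c)   ≡⟨ ≡.cong (s ·_) (C.inverseʳ c) ⟩
              s · e             ≡⟨ C.identityʳ s ⟩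
              s                 ∎)))))
            (inverseʳ _)) , C.inverseʳ c)
      ; ⁻¹-cong = λ { {x} {y} (f≈g , ≡.refl) → (λ s → ⁻¹-cong (f≈g (s · inv (proj₂ y)))) , ≡.refl }
      }
    }
    where
    open Group P
    open ≡.≡-Reasoning

  wreath-order : ∀ {p} {P : Group c ℓ} → k ≡ p → PPowerOrder p P → PPowerOrder p (wreath P)
  -- The base group contributes `p` coordinates of order `p ^ n`, and the acting group one more
  -- factor `p`.
  wreath-order {p = p} {P = P} ≡.refl (n , card) = n ℕ.* p ℕ.+ 1 ,
    ≡.subst (Finite (Group.setoid (wreath P)))
      (≡.trans (≡.cong₂ ℕ._*_ (ℕ.^-*-assoc p n p) (≡.sym (ℕ.*-identityʳ p)))
               (≡.sym (ℕ.^-distribˡ-+-* p (n ℕ.* p) 1)))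
      (×-finite (vector-finite k card)
                (mkFinite {S = ≡.setoid (Fin k)} id id id (λ _ → ≡.refl) (λ _ → ≡.refl)))

  wreath-map : ∀ {P : Group c ℓ₁} {Q : Group c′ ℓ₂} →
               Homomorphism P Q → Homomorphism (wreath P) (wreath Q)
  wreath-map h = record
    { fun = λ (f , c) → fun ∘ f , c
    ; cong = λ (e , e′) → (λ s → cong (e s)) , e′
    ; homo = λ (f , c) (g , d) → (λ s → homo (f s) (g (s · c))) , ≡.refl
    }
    where open Homomorphism h

  wreath-proj : ∀ (P : Group c ℓ₁) → Homomorphism (wreath P) finGroup
  wreath-proj P = record { fun = proj₂ ; cong = proj₂ ; homo = λ _ _ → ≡.refl }

  -- This is conjugation by the element of the base group with coordinates `κ`.
  twist : ∀ (P : Group c ℓ₁) → (Fin k → Group.Carrier P) → Homomorphism (wreath P) (wreath P)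
  twist P κ = record
    { fun = λ (f , c) → (λ s → κ s P.⁻¹ P.∙ f s P.∙ κ (s · c)) , c
    ; cong = λ { (f≈g , ≡.refl) → (λ s → P.∙-congʳ (P.∙-congˡ (f≈g s))) , ≡.refl }
    ; homo = λ (f , c) (g , d) → (λ s → begin
        κ s P.⁻¹ P.∙ (f s P.∙ g (s · c)) P.∙ κ (s · (c · d))
          ≈⟨ P.∙-congˡ (P.reflexive (≡.cong κ (C.assoc s c d))) ⟨
        κ s P.⁻¹ P.∙ (f s P.∙ g (s · c)) P.∙ κ ((s · c) · d)
          ≈⟨ P.∙-congʳ (P.assoc _ _ _) ⟨
        κ s P.⁻¹ P.∙ f s P.∙ g (s · c) P.∙ κ ((s · c) · d)
          ≈⟨ P.∙-congʳ (P.∙-congʳ (PP.//-rightDividesʳ (κ (s · c)) _)) ⟨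
        κ s P.⁻¹ P.∙ f s P.∙ κ (s · c) P.∙ κ (s · c) P.⁻¹ P.∙ g (s · c) P.∙ κ ((s · c) · d)
          ≈⟨ P.∙-congʳ (P.assoc _ _ _) ⟩
        κ s P.⁻¹ P.∙ f s P.∙ κ (s · c) P.∙ (κ (s · c) P.⁻¹ P.∙ g (s · c)) P.∙ κ ((s · c) · d)
          ≈⟨ P.assoc _ _ _ ⟩
        κ s P.⁻¹ P.∙ f s P.∙ κ (s · c) P.∙ (κ (s · c) P.⁻¹ P.∙ g (s · c) P.∙ κ ((s · c) · d)) ∎) , ≡.refl
    }
    where
    module P = Group P
    module PP = GroupProperties P
    open SetoidReasoning P.setoid

  translation : Fin k → Permutation.Permutation′ k
  translation c = Permutation.permutation (_· c) (_· inv c)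
    (cancel c (inv c) (C.inverseˡ c)) (cancel (inv c) c (C.inverseʳ c))
    where
    cancel : ∀ c d → d · c ≡ e → ∀ s → (s · d) · c ≡ s
    cancel c d dc s = ≡.trans (C.assoc s d c) (≡.trans (≡.cong (s ·_) dc) (C.identityʳ s))

module _ (A : CommutativeRing 0ℓ 0ℓ) where

  private module A = CommutativeRing A

  additive : Group 0ℓ 0ℓ
  additive = A.+-group

  -- Unitriangular 3×3 matrices; (a , b , h) has a and b next to the diagonal and h in the corner.
  heisenberg : Group 0ℓ 0ℓ
  heisenberg = record
    { Carrier = A.Carrier × A.Carrier × A.Carrier
    ; _≈_ = λ (a , b , h) (a′ , b′ , h′) → a A.≈ a′ × b A.≈ b′ × h A.≈ h′
    ; _∙_ = λ (a , b , h) (a′ , b′ , h′) → a A.+ a′ , b A.+ b′ , (h A.+ h′) A.+ a A.* b′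
    ; ε = A.0# , A.0# , A.0#
    ; _⁻¹ = λ (a , b , h) → A.- a , A.- b , (A.- h) A.+ a A.* b
    ; isGroup = record
      { isMonoid = record
        { isSemigroup = record
          { isMagma = record
            { isEquivalence = Setoid.isEquivalence (×-setoid A.setoid (×-setoid A.setoid A.setoid))
            ; ∙-cong = λ (e₁ , e₂ , e₃) (e₁′ , e₂′ , e₃′) →
                A.+-cong e₁ e₁′ , A.+-cong e₂ e₂′ , A.+-cong (A.+-cong e₃ e₃′) (A.*-cong e₁ e₂′)
            }
          ; assoc = λ (a , b , h) (a′ , b′ , h′) (a″ , b″ , h″) →
              A.+-assoc a a′ a″ , A.+-assoc b b′ b″ , assoc-corner a h h′ h″ a′ b′ b″
          }
        ; identity =
            (λ (a , b , h) → A.+-identityˡ a , A.+-identityˡ b , identityˡ-corner b h) ,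
            (λ (a , b , h) → A.+-identityʳ a , A.+-identityʳ b , identityʳ-corner a h)
        }
      ; inverse =
          (λ (a , b , h) → A.-‿inverseˡ a , A.-‿inverseˡ b , inverseˡ-corner a b h) ,
          (λ (a , b , h) → A.-‿inverseʳ a , A.-‿inverseʳ b , inverseʳ-corner a b h)
      ; ⁻¹-cong = λ (e₁ , e₂ , e₃) →
          A.-‿cong e₁ , A.-‿cong e₂ , A.+-cong (A.-‿cong e₃) (A.*-cong e₁ e₂)
      }
    }
    where
    open RingProperties A.ring using (-‿distribˡ-*; -‿distribʳ-*)
    -- In an abstract ring there is no test for zero, so the solver is used only for identities in
    -- which nothing cancels; inverses are cancelled by hand.
    ring : AlmostCommutativeRing 0ℓ 0ℓ
    ring = fromCommutativeRing A λ _ → nothing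
    open AlmostCommutativeRing ring using (_≈_; _+_; _*_; -_; 0#)

    assoc-corner : ∀ a h h′ h″ a′ b′ b″ →
      (((h + h′) + a * b′) + h″) + (a + a′) * b″ ≈ (h + ((h′ + h″) + a′ * b″)) + a * (b′ + b″)
    assoc-corner = solve-∀ ring
    identityˡ-corner : ∀ b h → (0# + h) + 0# * b ≈ h
    identityˡ-corner b h = A.trans (A.+-cong (A.+-identityˡ h) (A.zeroˡ b)) (A.+-identityʳ h)
    identityʳ-corner : ∀ a h → (h + 0#) + a * 0# ≈ h
    identityʳ-corner a h = A.trans (A.+-cong (A.+-identityʳ h) (A.zeroʳ a)) (A.+-identityʳ h)
    swap-middle : ∀ h m n o → (h + m) + n + o ≈ (h + n) + (m + o)
    swap-middle = solve-∀ ring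
    inverseˡ-corner : ∀ a b h → (((- h) + a * b) + h) + (- a) * b ≈ 0#
    inverseˡ-corner a b h = A.trans (swap-middle (- h) (a * b) h ((- a) * b))
      (A.trans (A.+-cong (A.-‿inverseˡ h)
        (A.trans (A.+-congˡ (A.sym (-‿distribˡ-* a b))) (A.-‿inverseʳ (a * b))))
      (A.+-identityˡ 0#))
    inverseʳ-corner : ∀ a b h → (h + ((- h) + a * b)) + a * (- b) ≈ 0#
    inverseʳ-corner a b h = A.trans (A.+-congʳ (A.sym (A.+-assoc h (- h) (a * b))))
      (A.trans (A.+-assoc (h + - h) (a * b) (a * - b))
      (A.trans (A.+-cong (A.-‿inverseʳ h)
        (A.trans (A.+-congˡ (A.sym (-‿distribʳ-* a b))) (A.-‿inverseʳ (a * b))))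
      (A.+-identityˡ 0#)))

  heis₁ heis₂ : Homomorphism heisenberg additive
  heis₁ = record { fun = proj₁ ; cong = proj₁ ; homo = λ x y → A.refl }
  heis₂ = record { fun = proj₁ ∘ proj₂ ; cong = proj₁ ∘ proj₂ ; homo = λ x y → A.refl }

  module _ {k} {_·_ : Fin k → Fin k → Fin k} {e inv} (C : IsGroup _≡_ _·_ e inv) where
    open Wreath C
    open Sums A.+-commutativeMonoid

    sum-translate : ∀ f c → sum (λ s → f (s · c)) A.≈ sum f
    sum-translate f c = A.sym (sum-permute f (translation c))

    -- Translations only permute the summands. Under Shapiro's lemma this homomorphism computes the
    -- corestriction.
    wreath-sum : Homomorphism (wreath additive) additive
    wreath-sum = record
      { fun = sum ∘ proj₁
      ; cong = λ (e , _) → sum-cong-≋ e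
      ; homo = λ (f , c) (g , d) →
          A.trans (∑-distrib-+ f (λ s → g (s · c))) (A.+-congˡ (sum-translate g c))
      }

-- The orders of `𝔽 p` and of its Heisenberg group

module _ (p : ℕ) .{{_ : NonZero p}} where

  private module F = CommutativeRing (𝔽 p)

  𝔽-finite : Finite F.setoid p
  𝔽-finite = mkFinite
    (λ z → fromℕ< (ℤ.n%ℕd<d z p))
    (λ i → ℤ.+ toℕ i)
    (λ {x} {y} e → Fin.fromℕ<-cong _ _ (residue-unique (ℤ.n%ℕd<d x p) (ℤ.n%ℕd<d y p)
      (F.trans {ℤ.+ (x ℤ.%ℕ p)} {x} (residue x)
        (F.trans {x} {y} e (F.sym {ℤ.+ (y ℤ.%ℕ p)} {y} (residue y))))) _ _)
    (λ i → ≡.trans (Fin.fromℕ<-cong _ _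
        (residue-unique (ℤ.n%ℕd<d (ℤ.+ toℕ i) p) (Fin.toℕ<n i) (residue (ℤ.+ toℕ i))) _ (Fin.toℕ<n i))
      (Fin.fromℕ<-toℕ i (Fin.toℕ<n i)))
    (λ z → F.trans {ℤ.+ toℕ (fromℕ< (ℤ.n%ℕd<d z p))} {ℤ.+ (z ℤ.%ℕ p)} {z}
      (F.reflexive (≡.cong ℤ.+_ (Fin.toℕ-fromℕ< (ℤ.n%ℕd<d z p)))) (residue z))
    where
    residue-eq : ∀ r q n → r ℤ.- (r ℤ.+ q ℤ.* n) ≡ (ℤ.- q) ℤ.* n
    residue-eq = ℤSolver.solve-∀

    residue : ∀ z → (ℤ.+ (z ℤ.%ℕ p)) F.≈ z
    residue z = divides (ℤ.- (z ℤ./ℕ p)) (≡.trans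
      (≡.cong (λ t → (ℤ.+ (z ℤ.%ℕ p)) ℤ.- t) (ℤ.a≡a%ℕn+[a/ℕn]*n z p))
      (residue-eq (ℤ.+ (z ℤ.%ℕ p)) (z ℤ./ℕ p) (ℤ.+ p)))

    residue-unique : ∀ {m n} → m ℕ.< p → n ℕ.< p → (ℤ.+ m) F.≈ (ℤ.+ n) → m ≡ n
    residue-unique {m} {n} m<p n<p e =
     ℤ.+-injective (ℤ.i-j≡0⇒i≡j _ _ (ℤ.∣i∣≡0⇒i≡0 (small (ℤ∣.∣⇒∣ᵤ e) (ℕ.≤-<-trans
      (ℕ.≤-trans (ℕ.≤-reflexive (≡.cong ℤ.∣_∣ (ℤ.m-n≡m⊖n m n))) (ℤ.∣m⊝n∣≤m⊔n m n)) (ℕ.⊔-lub m<p n<p)))))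
      where
      small : ∀ {k} → p ℕ∣.∣ k → k ℕ.< p → k ≡ 0
      small {zero}  _ _ = ≡.refl
      small {suc k} d l = ⊥-elim (ℕ.<⇒≱ l (ℕ∣.∣⇒≤ d))

  𝔽-order : PPowerOrder p (additive (𝔽 p))
  𝔽-order = 1 , ≡.subst (Finite F.setoid) (≡.sym (ℕ.*-identityʳ p)) 𝔽-finite

  heisenberg-order : PPowerOrder p (heisenberg (𝔽 p))
  heisenberg-order = 3 , ≡.subst (Finite (Group.setoid (heisenberg (𝔽 p))))
    (≡.cong (λ q → p ℕ.* (p ℕ.* q)) (≡.sym (ℕ.*-identityʳ p)))
    (×-finite 𝔽-finite (×-finite 𝔽-finite 𝔽-finite))

-- Continuous homomorphisms to discrete groups

-- A discrete target P makes continuity of a homomorphism the same as triviality near ε.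
record ContinuousHom (H : TopologicalGroup c ℓ) (P : Group 0ℓ 0ℓ) : Set (c ⊔ lsuc ℓ) where
  open TopologicalGroup H
  private module P = Group P
  field
    homomorphism    : Homomorphism group P
    locally-trivial : ∃[ V ] IsOpen V × V ε × (∀ {x} → V x → Homomorphism.fun homomorphism x P.≈ P.ε)
  open Homomorphism homomorphism public

  -- Write `x′` near `x` as `x ∙ (x ⁻¹ ∙ x′)`. By continuity of the product the second factor lies
  -- in the neighbourhood of `ε` on which the homomorphism is trivial.
  fiber-open : ∀ y → IsOpen (λ x → Lift ℓ (fun x P.≈ y))
  fiber-open y = open-⋃ λ x (lift fx≈y) →
    let (V , oV , Vε , trivial) = locally-trivial
        (_ , W , _ , oW , w′ , w , h) = ∙-cont (x ⁻¹) x oV (open-resp oV (sym (inverseˡ x)) Vε)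
    in W , oW , w , λ {x′} w″ → lift (P.trans (P.trans
         (cong (sym (GroupProperties.\\-leftDividesˡ group x x′)))
         (P.trans (homo x (x ⁻¹ ∙ x′)) (P.trans (P.∙-congˡ (trivial (h w′ w″))) (P.identityʳ _))))
         fx≈y)

  kernelOpen : OpenSubgroup H
  kernelOpen = record { subgroup = kernel ℓ homomorphism ; isOpen = fiber-open P.ε }

module _ {H : TopologicalGroup c ℓ} where
  open TopologicalGroup H

  infixr 9 _∘ʰ_
  _∘ʰ_ : ∀ {P Q} → Homomorphism P Q → ContinuousHom H P → ContinuousHom H Q
  _∘ʰ_ {P} {Q} g f = record
    { homomorphism = record
      { fun = g.fun ∘ f.fun
      ; cong = g.cong ∘ f.cong
      ; homo = λ x y → Q.trans (g.cong (f.homo x y)) (g.homo _ _)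
      }
    ; locally-trivial =
        let (V , oV , Vε , trivial) = f.locally-trivial
        in V , oV , Vε , λ v → Q.trans (g.cong (trivial v)) g.ε-homo
    }
    where
    module g = Homomorphism g
    module f = ContinuousHom f
    module Q = Group Q

  trivialHom : ∀ P → ContinuousHom H P
  trivialHom P = record
    { homomorphism = record
      { fun = λ _ → P.ε ; cong = λ _ → P.refl ; homo = λ _ _ → P.sym (P.identityˡ _) }
    ; locally-trivial = _ , open-⊤ , lift tt , λ _ → P.refl
    }
    where module P = Group P

  module _ {P Q} (f : ContinuousHom H P) (g : ContinuousHom H Q) where
    private
      module f = ContinuousHom f
      module g = ContinuousHom g

    common-neighbourhood : ∃[ V ] IsOpen V × V ε ×
      (∀ {x} → V x → Group._≈_ P (f.fun x) (Group.ε P) × Group._≈_ Q (g.fun x) (Group.ε Q))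
    common-neighbourhood =
      let (V , oV , Vε , triv) = f.locally-trivial
          (W , oW , Wε , triv′) = g.locally-trivial
      in _ , open-∩ oV oW , (Vε , Wε) , λ (v , w) → triv v , triv′ w

-- This covers both lifting problems of the proof: from two copies of `additive A` to
-- `heisenberg A`, and the same after applying `wreath`.
LiftsAlong : ∀ {H : TopologicalGroup c ℓ} {Q P₁ P₂} → Homomorphism Q P₁ → Homomorphism Q P₂ →
             ContinuousHom H P₁ → ContinuousHom H P₂ → Set (c ⊔ lsuc ℓ)
LiftsAlong {H = H} {Q} {P₁} {P₂} π₁ π₂ α β = Σ (ContinuousHom H Q) λ Φ → ∀ x →
  Group._≈_ P₁ (Homomorphism.fun π₁ (ContinuousHom.fun Φ x)) (ContinuousHom.fun α x) ×
  Group._≈_ P₂ (Homomorphism.fun π₂ (ContinuousHom.fun Φ x)) (ContinuousHom.fun β x)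

module _ {H : TopologicalGroup c ℓ} {G : TopologicalGroup c′ ℓ′} where
  private
    module H = TopologicalGroup H
    module G = TopologicalGroup G

  ContinuousAtε : Homomorphism H.group G.group → Set (c ⊔ lsuc ℓ ⊔ c′ ⊔ lsuc ℓ′)
  ContinuousAtε f = ∀ {V} → G.IsOpen V → V G.ε →
    ∃[ W ] H.IsOpen W × W H.ε × (∀ {x} → W x → V (Homomorphism.fun f x))

  precompose : ∀ {P} (f : Homomorphism H.group G.group) → ContinuousAtε f →
               ContinuousHom G P → ContinuousHom H P
  precompose {P} f cont Φ = record
    { homomorphism = record
      { fun = Φ.fun ∘ f.fun
      ; cong = Φ.cong ∘ f.cong
      ; homo = λ x y → Group.trans P (Φ.cong (f.homo x y)) (Φ.homo (f.fun x) (f.fun y))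
      }
    ; locally-trivial =
        let (V , oV , Vε , trivial) = Φ.locally-trivial
            (W , oW , Wε , h) = cont oV Vε
        in W , oW , Wε , trivial ∘ h
    }
    where
    module f = Homomorphism f
    module Φ = ContinuousHom Φ

  module _ (V : OpenSubgroup H) (U : OpenSubgroup G) (f : Homomorphism H.group G.group)
           (mem : ∀ {x} → OpenSubgroup.Mem V x → OpenSubgroup.Mem U (Homomorphism.fun f x)) where
    open Homomorphism f

    restrictBoth : Homomorphism (TopologicalGroup.group (openSubgroup V))
                                (TopologicalGroup.group (openSubgroup U))
    restrictBoth = record
      { fun = λ (x , m) → fun x , mem m ; cong = cong ; homo = λ x y → homo (proj₁ x) (proj₁ y) }

    restrictBoth-continuous : ContinuousAtε f → ∀ {X} → TopologicalGroup.IsOpen (openSubgroup U) X →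
      X (TopologicalGroup.ε (openSubgroup U)) →
      ∃[ W ] TopologicalGroup.IsOpen (openSubgroup V) W × W (TopologicalGroup.ε (openSubgroup V)) ×
             (∀ {x} → W x → X (Homomorphism.fun restrictBoth x))
    restrictBoth-continuous cont (rX , oX) Xε =
      let (W , oW , Wε , h) = cont oX (_ , Xε)
      in restrict V W , restrict-open V oW , Wε , λ w → rX G.refl (proj₂ (h w))

module _ {H : TopologicalGroup c ℓ} (U : OpenSubgroup H)
         {k} (index : HasIndex (OpenSubgroup.subgroup U) k) where
  open TopologicalGroup H
  open OpenSubgroup U
  open Inverse index

  -- This is the Reidemeister-Schreier cocycle of the chosen coset representatives, the same element
  -- of `U` as in `corestriction`.
  transfer : Fin k → Carrier → Σ Carrier Mem
  transfer s x = from s ∙ x ∙ from (to (from s ∙ x)) ⁻¹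
               , Setoid.sym (rightCosets subgroup) {from (to (from s ∙ x))} {from s ∙ x}
                   (strictlyInverseʳ (from s ∙ x))

  -- The corestriction H¹(U) → H¹(H), for classes viewed as homomorphisms.
  transferSum : (A : CommutativeRing 0ℓ 0ℓ) → ContinuousHom (openSubgroup U) (additive A) →
                Carrier → CommutativeRing.Carrier A
  transferSum A β x = Sums.sum (CommutativeRing.+-commutativeMonoid A)
    λ s → ContinuousHom.fun β (transfer s x)

module _ (A : CommutativeRing 0ℓ 0ℓ) where
  private module A = CommutativeRing A

  module _ {H : TopologicalGroup c ℓ} where
    open TopologicalGroup H

    -- The cup product of α and β vanishes exactly when (α , β) lifts to the Heisenberg group.
    Lifts : (α β : ContinuousHom H (additive A)) → Set (c ⊔ lsuc ℓ)
    Lifts = LiftsAlong (heis₁ A) (heis₂ A)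

    IsRadical : ContinuousHom H (additive A) → Set (c ⊔ lsuc ℓ)
    IsRadical α = ∀ β → Lifts α β

  KijimaNishiHom : ℕ → TopologicalGroup c ℓ → Set (c ⊔ lsuc ℓ)
  KijimaNishiHom p G =
    (U : OpenSubgroup G) → Normal (TopologicalGroup.group G) (OpenSubgroup.subgroup U) →
    (index : HasIndex (OpenSubgroup.subgroup U) p) →
    (α : ContinuousHom G (additive A)) → IsRadical α →
    Σ (ContinuousHom (openSubgroup U) (additive A)) λ β → IsRadical β ×
      (∀ x → transferSum U index A β x A.≈ ContinuousHom.fun α x)

  -- Cocycles of degree one and their cup products

  module Dictionary (H : TopologicalGroup c ℓ) where
    open import Data.Vec.Functional using ([]; _∷_)
    open TopologicalGroup H
    open Cohomology A H
    open SetoidReasoning A.setoid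
    private
      ring : AlmostCommutativeRing 0ℓ 0ℓ
      ring = fromCommutativeRing A λ _ → nothing
      module R = AlmostCommutativeRing ring
      module GP = GroupProperties group
      module RP = RingProperties A.ring

      ε\\ : ∀ {x} → ε ⁻¹ ∙ x ≈ x
      ε\\ = trans (∙-congʳ GP.ε⁻¹≈ε) (identityˡ _)

      telescope : ∀ x y z → (x ⁻¹ ∙ y) ∙ (y ⁻¹ ∙ z) ≈ x ⁻¹ ∙ z
      telescope x y z = trans (assoc _ _ _) (∙-congˡ (GP.\\-leftDividesˡ y z))


    -- Open sets respect equality in the group, hence so do locally constant functions. This takes
    -- the place of function extensionality for tuples.
    continuous-resp : ∀ {n} {f : Vector Carrier n → A.Carrier} → Continuous f →
                      ∀ {x y} → (∀ k → x k ≈ y k) → f y A.≈ f x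
    continuous-resp cont {x} {y} e =
      let (V , oV , v , h) = cont x in h y λ k → open-resp (oV k) (e k) (v k)

    η : ∀ {x₀ x₁ : Carrier} (x : Vector Carrier 2) → x₀ ≈ x zero → x₁ ≈ x (suc zero) →
        ∀ k → (x₀ ∷ x₁ ∷ []) k ≈ x k
    η x e e′ zero = e
    η x e e′ (suc zero) = e′

    inhomogeneous : (Vector Carrier 2 → A.Carrier) → Carrier → A.Carrier
    inhomogeneous f x = f (ε ∷ x ∷ [])

    module _ (f : Cochain 1) where
      open Cochain f

      inhomogeneous-cong : ∀ {x y} → x ≈ y → inhomogeneous fun x A.≈ inhomogeneous fun y
      inhomogeneous-cong e = A.sym (continuous-resp continuous (η _ refl e))

      homogeneous : ∀ x → fun x A.≈ inhomogeneous fun (x zero ⁻¹ ∙ x (suc zero))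
      homogeneous x = A.trans (A.sym (invariant (x zero ⁻¹) x))
        (continuous-resp continuous (η _ (sym (inverseˡ (x zero))) refl))

      inhomogeneous-local : ∃[ V ] IsOpen V × V ε ×
                            (∀ {y} → V y → inhomogeneous fun y A.≈ inhomogeneous fun ε)
      inhomogeneous-local =
        let (V , oV , v , h) = continuous (ε ∷ ε ∷ [])
        in V (suc zero) , oV (suc zero) , v (suc zero) , λ {y} w →
           h (ε ∷ y ∷ []) λ { zero → v zero ; (suc zero) → w }

    -- Only open fibres are required, not additivity, because the corner of a lift to the Heisenberg
    -- group has to become a cochain too.
    cochain : (k : Carrier → A.Carrier) → (∀ {x y} → x ≈ y → k x A.≈ k y) →
              (∀ c → IsOpen (λ x → Lift ℓ (k x A.≈ c))) → Cochain 1
    cochain k k-cong fiber = record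
      { fun = λ x → k (x zero ⁻¹ ∙ x (suc zero))
      ; continuous = λ x →
          let (W , W′ , oW , oW′ , w , w′ , h) = ∙-cont (x zero ⁻¹) (x (suc zero)) (fiber _) (lift A.refl)
              (W″ , oW″ , w″ , h′) = ⁻¹-cont (x zero) oW w
          in W″ ∷ W′ ∷ [] , (λ { zero → oW″ ; (suc zero) → oW′ }) ,
             (λ { zero → w″ ; (suc zero) → w′ }) ,
             λ y v → lower (h (h′ (v zero)) (v (suc zero)))
      ; invariant = λ g x → k-cong (trans (∙-congʳ (GP.⁻¹-anti-homo-∙ g (x zero)))
          (trans (assoc _ _ _) (∙-congˡ (GP.\\-leftDividesʳ g (x (suc zero))))))
      }

    -- An invariant cochain of degree zero is constant. Consequently cohomologous cocycles of degree
    -- one are equal, and their classes are homomorphisms.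
    δ₀ : (f : Cochain 0) → ∀ x → δ (Cochain.fun f) x A.≈ A.0#
    δ₀ f x = begin
      A.1# A.* f₁ A.+ ((A.- A.1# A.* A.1#) A.* f₀ A.+ A.0#)
        ≈⟨ A.+-cong (A.*-identityˡ f₁) (A.trans (A.+-identityʳ _)
             (A.trans (A.*-congʳ (A.*-identityʳ _)) (RP.-1*x≈-x f₀))) ⟩
      f₁ A.+ A.- f₀
        ≈⟨ A.+-congˡ (A.-‿cong (A.trans (A.sym (invariant (x (suc zero) ∙ x zero ⁻¹) _))
             (continuous-resp continuous λ { zero → sym (GP.//-rightDividesˡ (x zero) (x (suc zero))) }))) ⟩
      f₁ A.+ A.- f₁
        ≈⟨ A.-‿inverseʳ f₁ ⟩
      A.0# ∎
      where
      open Cochain f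
      f₁ = fun (removeAt x zero)
      f₀ = fun (removeAt x (suc zero))

    δ₁ : ∀ (f : Cochain 1) x → let k = inhomogeneous (Cochain.fun f) in
         δ (Cochain.fun f) x A.≈
         k (x (suc zero) ⁻¹ ∙ x (suc (suc zero))) A.+
         ((A.- k (x zero ⁻¹ ∙ x (suc (suc zero)))) A.+ k (x zero ⁻¹ ∙ x (suc zero)))
    δ₁ f x = A.+-cong (A.trans (A.*-identityˡ _) (homogeneous f _)) (A.+-cong
      (A.trans (A.*-congʳ (A.*-identityʳ _)) (A.trans (RP.-1*x≈-x _) (A.-‿cong (homogeneous f _))))
      (A.trans (A.+-identityʳ _) (A.trans (A.*-congʳ (A.trans (A.*-congˡ (A.*-identityʳ _))
         (A.trans (RP.-1*x≈-x _) (RP.-‿involutive _)))) (A.trans (A.*-identityˡ _) (homogeneous f _)))))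

    cohomologous⇒≈ : ∀ {f g : Vector Carrier 2 → A.Carrier} → Cohomologous f g → ∀ x → f x A.≈ g x
    cohomologous⇒≈ (h , e) x = RP.x∙y⁻¹≈ε⇒x≈y _ _ (A.trans (e x) (δ₀ h x))

    ≈⇒cohomologous : ∀ {f g : Vector Carrier 2 → A.Carrier} → (∀ x → f x A.≈ g x) → Cohomologous f g
    ≈⇒cohomologous {f} {g} e = h , λ x → A.trans (RP.x≈y⇒x∙y⁻¹≈ε (e x)) (A.sym (δ₀ h x))
      where
      h : Cochain 0
      h = record
        { fun = λ _ → A.0#
        ; continuous = λ x → (λ _ _ → Lift _ _) , (λ _ → open-⊤) , (λ _ → lift tt) , λ _ _ → A.refl
        ; invariant = λ _ _ → A.refl
        }

    toHom : Cocycle 1 → ContinuousHom H (additive A)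
    toHom f = record
      { homomorphism = homomorphism
      ; locally-trivial =
          let (V , oV , v , h) = inhomogeneous-local cochain′
          in V , oV , v , λ w → A.trans (h w) (Homomorphism.ε-homo homomorphism)
      }
      where
      open Cocycle f renaming (cochain to cochain′)
      a = inhomogeneous fun
      homomorphism : Homomorphism group (additive A)
      homomorphism = record
        { fun = a
        ; cong = inhomogeneous-cong cochain′
        -- Additivity is the cocycle condition at `ε`, `x` and `x ∙ y`.
        ; homo = λ x y → begin
            a (x ∙ y)
              ≈⟨ A.trans (A.sym (A.+-identityʳ _)) (A.+-congˡ (A.sym (closed (ε ∷ x ∷ x ∙ y ∷ [])))) ⟩
            a (x ∙ y) A.+ δ fun (ε ∷ x ∷ x ∙ y ∷ [])
              ≈⟨ A.+-congˡ (A.trans (δ₁ cochain′ (ε ∷ x ∷ x ∙ y ∷ [])) (A.+-cong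
                   (inhomogeneous-cong cochain′ (GP.\\-leftDividesʳ x y))
                   (A.+-cong (A.-‿cong (inhomogeneous-cong cochain′ ε\\)) (inhomogeneous-cong cochain′ ε\\)))) ⟩
            a (x ∙ y) A.+ (a y A.+ (A.- a (x ∙ y) A.+ a x))
              ≈⟨ rearrange (a (x ∙ y)) (a y) (A.- a (x ∙ y)) (a x) ⟩
            (a (x ∙ y) A.+ A.- a (x ∙ y)) A.+ (a x A.+ a y)
              ≈⟨ A.trans (A.+-congʳ (A.-‿inverseʳ _)) (A.+-identityˡ _) ⟩
            a x A.+ a y ∎
        }
        where
        rearrange : ∀ s t u v → s R.+ (t R.+ (u R.+ v)) R.≈ (s R.+ u) R.+ (v R.+ t)
        rearrange = solve-∀ ring

    fromHom : ContinuousHom H (additive A) → Cocycle 1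
    fromHom f = record
      { cochain = cochain′
      ; closed = λ x →
          let u = x zero ⁻¹ ∙ x (suc zero)
              v = x (suc zero) ⁻¹ ∙ x (suc (suc zero))
          in begin
            δ (Cochain.fun cochain′) x
              ≈⟨ A.trans (δ₁ cochain′ x) (A.+-cong (cong ε\\)
                   (A.+-cong (A.-‿cong (cong (trans ε\\ (sym (telescope _ _ _))))) (cong ε\\))) ⟩
            fun v A.+ (A.- fun (u ∙ v) A.+ fun u)
              ≈⟨ A.+-congˡ (A.+-congʳ (A.-‿cong (homo u v))) ⟩
            fun v A.+ (A.- (fun u A.+ fun v) A.+ fun u)
              ≈⟨ rearrange (fun v) (A.- (fun u A.+ fun v)) (fun u) ⟩
            (fun u A.+ fun v) A.+ A.- (fun u A.+ fun v)
              ≈⟨ A.-‿inverseʳ _ ⟩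
            A.0# ∎
      }
      where
      open ContinuousHom f
      cochain′ = cochain fun cong fiber-open
      rearrange : ∀ s t u → s R.+ (t R.+ u) R.≈ (u R.+ s) R.+ t
      rearrange = solve-∀ ring

    toHom-homogeneous : ∀ (f : Cocycle 1) x →
      Cocycle.fun f x A.≈ ContinuousHom.fun (toHom f) (x zero ⁻¹ ∙ x (suc zero))
    toHom-homogeneous f = homogeneous (Cocycle.cochain f)

    -- If `h` cobounds the cup product, then `a x * b y = k y - k (x ∙ y) + k x`. This is exactly
    -- the condition for `- k` in the corner to make the triple multiplicative.
    InR⇒IsRadical : ∀ f → InR f → IsRadical (toHom f)
    InR⇒IsRadical f f∈R b = Φ , λ x → A.refl , A.refl
      where
      module a = ContinuousHom (toHom f)
      module b = ContinuousHom b
      h = proj₁ (f∈R (fromHom b))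
      k = inhomogeneous (Cochain.fun h)
      cup : ∀ x y → a.fun x A.* b.fun y A.≈ k y A.+ (A.- k (x ∙ y) A.+ k x)
      cup x y = begin
        a.fun x A.* b.fun y
          ≈⟨ A.*-cong (continuous-resp (Cocycle.continuous f) (λ { zero → refl ; (suc zero) → refl }))
                      (b.cong (sym (GP.\\-leftDividesʳ x y))) ⟩
        (Cocycle.fun f ⌣ Cocycle.fun (fromHom b)) (ε ∷ x ∷ x ∙ y ∷ [])
          ≈⟨ proj₂ (f∈R (fromHom b)) (ε ∷ x ∷ x ∙ y ∷ []) ⟩
        δ (Cochain.fun h) (ε ∷ x ∷ x ∙ y ∷ [])
          ≈⟨ δ₁ h (ε ∷ x ∷ x ∙ y ∷ []) ⟩
        _ ≈⟨ A.+-cong (inhomogeneous-cong h (GP.\\-leftDividesʳ x y))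
               (A.+-cong (A.-‿cong (inhomogeneous-cong h ε\\)) (inhomogeneous-cong h ε\\)) ⟩
        k y A.+ (A.- k (x ∙ y) A.+ k x) ∎

      corner : ∀ s t u → A.- u A.≈ (A.- s A.+ A.- t) A.+ (t A.+ (A.- u A.+ s))
      corner s t u = begin
        A.- u ≈⟨ A.trans (A.+-congʳ (A.trans (A.+-cong (A.-‿inverseˡ s) (A.-‿inverseˡ t)) (A.+-identityˡ _)))
                      (A.+-identityˡ _) ⟨
        ((A.- s A.+ s) A.+ (A.- t A.+ t)) A.+ A.- u ≈⟨ rearrange (A.- s) s (A.- t) t (A.- u) ⟩
        (A.- s A.+ A.- t) A.+ (t A.+ (A.- u A.+ s)) ∎
        where
        rearrange : ∀ s′ s t′ t u → ((s′ R.+ s) R.+ (t′ R.+ t)) R.+ u R.≈ (s′ R.+ t′) R.+ (t R.+ (u R.+ s))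
        rearrange = solve-∀ ring

      homomorphism : Homomorphism group (heisenberg A)
      homomorphism = record
        { fun = λ x → a.fun x , b.fun x , A.- k x
        ; cong = λ e → a.cong e , b.cong e , A.-‿cong (inhomogeneous-cong h e)
        ; homo = λ x y → a.homo x y , b.homo x y ,
            A.trans (corner (k x) (k y) (k (x ∙ y))) (A.+-congˡ (A.sym (cup x y)))
        }

      Φ : ContinuousHom H (heisenberg A)
      Φ = record
        { homomorphism = homomorphism
        ; locally-trivial =
            let (V , oV , Vε , triv) = common-neighbourhood (toHom f) b
                (W , oW , Wε , const) = inhomogeneous-local h
            in _ , open-∩ oV oW , (Vε , Wε) , λ (v , w) →
               proj₁ (triv v) , proj₂ (triv v) ,
               A.trans (A.-‿cong (const w)) (proj₂ (proj₂ (Homomorphism.ε-homo homomorphism)))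
        }

    -- The multiplication rule in the corner says that the differential of the negated corner `- k`
    -- is the cup product.
    Lifts⇒⌣-coboundary : ∀ (f g : Cocycle 1) → Lifts (toHom f) (toHom g) →
                         IsCoboundary (Cocycle.fun f ⌣ Cocycle.fun g)
    Lifts⇒⌣-coboundary f g (Φ , lifts) = h , λ x →
      let u = x zero ⁻¹ ∙ x (suc zero)
          v = x (suc zero) ⁻¹ ∙ x (suc (suc zero))
      in begin
        (Cocycle.fun f ⌣ Cocycle.fun g) x
          ≈⟨ A.*-cong (toHom-homogeneous f _) (toHom-homogeneous g _) ⟩
        a.fun u A.* b.fun v
          ≈⟨ A.*-cong (proj₁ (lifts u)) (proj₂ (lifts v)) ⟨
        proj₁ (Φ.fun u) A.* proj₁ (proj₂ (Φ.fun v))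
          ≈⟨ corner (k u) (k v) _ ⟩
        A.- k v A.+ (A.- A.- ((k u A.+ k v) A.+ proj₁ (Φ.fun u) A.* proj₁ (proj₂ (Φ.fun v))) A.+ A.- k u)
          ≈⟨ A.+-congˡ (A.+-congʳ (A.-‿cong (A.-‿cong (proj₂ (proj₂ (Φ.homo u v)))))) ⟨
        A.- k v A.+ (A.- A.- k (u ∙ v) A.+ A.- k u)
          ≈⟨ A.+-cong (A.-‿cong (k-cong ε\\)) (A.+-cong (A.-‿cong (A.-‿cong (k-cong
               (trans ε\\ (sym (telescope _ _ _)))))) (A.-‿cong (k-cong ε\\))) ⟨
        _ ≈⟨ δ₁ h x ⟨
        δ (Cochain.fun h) x ∎
      where
      module a = ContinuousHom (toHom f)
      module b = ContinuousHom (toHom g)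
      module Φ = ContinuousHom Φ
      k : Carrier → A.Carrier
      k x = proj₂ (proj₂ (Φ.fun x))
      k-cong : ∀ {x y} → x ≈ y → k x A.≈ k y
      k-cong e = proj₂ (proj₂ (Φ.cong e))

      corner : ∀ s t u → u A.≈ A.- t A.+ (A.- A.- ((s A.+ t) A.+ u) A.+ A.- s)
      corner s t u = begin
        u ≈⟨ A.trans (A.+-congʳ (A.trans (A.+-cong (A.-‿inverseˡ s) (A.-‿inverseˡ t)) (A.+-identityˡ _)))
                      (A.+-identityˡ _) ⟨
        ((A.- s A.+ s) A.+ (A.- t A.+ t)) A.+ u ≈⟨ rearrange (A.- s) s (A.- t) t u ⟩
        A.- t A.+ (((s A.+ t) A.+ u) A.+ A.- s) ≈⟨ A.+-congˡ (A.+-congʳ (RP.-‿involutive _)) ⟨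
        A.- t A.+ (A.- A.- ((s A.+ t) A.+ u) A.+ A.- s) ∎
        where
        rearrange : ∀ s′ s t′ t u → ((s′ R.+ s) R.+ (t′ R.+ t)) R.+ u R.≈ t′ R.+ (((s R.+ t) R.+ u) R.+ s′)
        rearrange = solve-∀ ring

      fiber : ∀ c → IsOpen (λ x → Lift ℓ (A.- k x A.≈ c))
      fiber c = open-⋃ λ x (lift e) → _ , Φ.fiber-open (Φ.fun x) , lift (Group.refl (heisenberg A)) ,
        λ (lift e′) → lift (A.trans (A.-‿cong (proj₂ (proj₂ e′))) e)

      h : Cochain 1
      h = cochain (λ x → A.- k x) (λ e → A.-‿cong (k-cong e)) fiber

    IsRadical⇒InR : ∀ a → IsRadical a → InR (fromHom a)
    IsRadical⇒InR a radical g =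
      let (Φ , lifts) = radical (toHom g)
      in Lifts⇒⌣-coboundary (fromHom a) g
           (Φ , λ x → A.trans (proj₁ (lifts x)) (ContinuousHom.cong a (sym ε\\)) , proj₂ (lifts x))

-- Corestriction of cochains and the transfer sum

module _ (A : CommutativeRing 0ℓ 0ℓ) (p : ℕ) {G : TopologicalGroup c ℓ} where
  open import Data.Vec.Functional using ([]; _∷_)
  private
    module A = CommutativeRing A
    module G = TopologicalGroup G
    module GP = GroupProperties G.group
    module DG = Dictionary A G
    module HG = Cohomology A G
    module AP = GroupProperties A.+-group
    open Sums A.+-commutativeMonoid
    open SetoidReasoning A.setoid

  module _ (U : OpenSubgroup G) (index : HasIndex (OpenSubgroup.subgroup U) p) where
    private
      module U = OpenSubgroup U
      module UG = Group (subgroupGroup U.subgroup)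
      open Inverse index

      cor : (Vector (Σ G.Carrier U.Mem) 2 → A.Carrier) → Vector G.Carrier 2 → A.Carrier
      cor = corestriction A U index

      ts : ContinuousHom (openSubgroup U) (additive A) → G.Carrier → A.Carrier
      ts = transferSum U index A

    corestriction-homogeneous : ∀ (β : ContinuousHom (openSubgroup U) (additive A))
      (f : Vector (Σ G.Carrier U.Mem) 2 → A.Carrier) →
      (∀ x → f x A.≈ ContinuousHom.fun β (x zero UG.⁻¹ UG.∙ x (suc zero))) →
      ∀ x → ts β (x zero) A.+ cor f x A.≈ ts β (x (suc zero))
    corestriction-homogeneous β f f≈β x = begin
      ts β (x zero) A.+ cor f x
        ≈⟨ ∑-distrib-+ (λ j → β.fun (red j zero)) (λ j → f (red j)) ⟨
      sum (λ j → β.fun (red j zero) A.+ f (red j))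
        ≈⟨ sum-cong-≋ (λ j → begin
             β.fun (red j zero) A.+ f (red j)
               ≈⟨ A.+-congˡ (f≈β (red j)) ⟩
             β.fun (red j zero) A.+ β.fun (red j zero UG.⁻¹ UG.∙ red j (suc zero))
               ≈⟨ β.homo (red j zero) (red j zero UG.⁻¹ UG.∙ red j (suc zero)) ⟨
             β.fun (red j zero UG.∙ (red j zero UG.⁻¹ UG.∙ red j (suc zero)))
               ≈⟨ β.cong (GP.\\-leftDividesˡ (proj₁ (red j zero)) (proj₁ (red j (suc zero)))) ⟩
             β.fun (red j (suc zero)) ∎) ⟩
      ts β (x (suc zero)) ∎
      where
      module β = ContinuousHom β
      red : Fin p → Fin 2 → Σ G.Carrier U.Mem
      red j i = transfer U index j (x i)

    transferSum-ε : ∀ β → ts β G.ε A.≈ A.0#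
    transferSum-ε β = A.trans
      (sum-cong-≋ λ j → A.trans (β.cong {y = UG.ε} (G.trans
          (G.∙-cong (G.identityʳ (from j)) (G.⁻¹-cong (G.reflexive (≡.cong from (to-from-ε j)))))
          (G.inverseʳ (from j)))) β.ε-homo)
      (sum-replicate-zero p)
      where
      module β = ContinuousHom β
      to-from-ε : ∀ j → to (from j G.∙ G.ε) ≡ j
      to-from-ε j = ≡.trans
        (to-cong (U.resp (G.sym (GP.x≈y⇒x∙y⁻¹≈ε (G.identityʳ (from j)))) U.ε-mem))
        (strictlyInverseˡ j)

  -- At `𝔽 p` this unfolds to the same type as `KijimaNishi p G`.
  KijimaNishiOver : Set (c ⊔ lsuc ℓ)
  KijimaNishiOver =
    (U : OpenSubgroup G) → let module U = OpenSubgroup U in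
    Normal G.group U.subgroup →
    (index : HasIndex U.subgroup p) →
    let module HU = Cohomology A (openSubgroup U) in
    (α : HG.Cocycle 1) → HG.InR α →
    Σ (HU.Cocycle 1) λ β → HU.InR β ×
      HG.Cohomologous (corestriction A U index (HU.Cocycle.fun β)) (HG.Cocycle.fun α)

  over⇒hom : KijimaNishiOver → KijimaNishiHom A p G
  over⇒hom kn U normal index α radical =
    let (β , β∈R , cohom) = kn U normal index (DG.fromHom α) (DG.IsRadical⇒InR α radical)
    in DU.toHom β , DU.InR⇒IsRadical β β∈R , λ x →
       let x̂ = G.ε ∷ x ∷ [] in begin
         transferSum U index A (DU.toHom β) x
           ≈⟨ corestriction-homogeneous U index (DU.toHom β) (HU.Cocycle.fun β) (DU.toHom-homogeneous β) x̂ ⟨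
         transferSum U index A (DU.toHom β) G.ε A.+ corestriction A U index (HU.Cocycle.fun β) x̂
           ≈⟨ A.+-cong (transferSum-ε U index (DU.toHom β))
                (DG.cohomologous⇒≈ {corestriction A U index (HU.Cocycle.fun β)} cohom x̂) ⟩
         A.0# A.+ ContinuousHom.fun α (G.ε G.⁻¹ G.∙ x)
           ≈⟨ A.+-identityˡ _ ⟩
         ContinuousHom.fun α (G.ε G.⁻¹ G.∙ x)
           ≈⟨ ContinuousHom.cong α (G.trans (G.∙-congʳ GP.ε⁻¹≈ε) (G.identityˡ x)) ⟩
         ContinuousHom.fun α x ∎
    where
    module DU = Dictionary A (openSubgroup U)
    module HU = Cohomology A (openSubgroup U)

  hom⇒over : KijimaNishiHom A p G → KijimaNishiOver
  hom⇒over kn U normal index α α∈R =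
    let (β , radical , sum≈α) = kn U normal index α′ (DG.InR⇒IsRadical α α∈R)
        f = HU.Cocycle.fun (DU.fromHom β)
    in DU.fromHom β , DU.IsRadical⇒InR β radical ,
       DG.≈⇒cohomologous {corestriction A U index f} λ x → AP.∙-cancelˡ (a.fun (x zero)) _ _ (begin
         a.fun (x zero) A.+ corestriction A U index f x
           ≈⟨ A.+-congʳ (A.sym (sum≈α (x zero))) ⟩
         transferSum U index A β (x zero) A.+ corestriction A U index f x
           ≈⟨ corestriction-homogeneous U index β f (λ x → A.refl) x ⟩
         transferSum U index A β (x (suc zero))
           ≈⟨ sum≈α (x (suc zero)) ⟩
         a.fun (x (suc zero))
           ≈⟨ a.cong (GP.\\-leftDividesˡ (x zero) (x (suc zero))) ⟨
         a.fun (x zero G.∙ (x zero G.⁻¹ G.∙ x (suc zero)))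
           ≈⟨ a.homo (x zero) (x zero G.⁻¹ G.∙ x (suc zero)) ⟩
         a.fun (x zero) A.+ a.fun (x zero G.⁻¹ G.∙ x (suc zero))
           ≈⟨ A.+-congˡ (DG.toHom-homogeneous α x) ⟨
         a.fun (x zero) A.+ HG.Cocycle.fun α x ∎)
    where
    module DU = Dictionary A (openSubgroup U)
    module HU = Cohomology A (openSubgroup U)
    α′ = DG.toHom α
    module a = ContinuousHom α′

KijimaNishi⇒KijimaNishiHom : ∀ p {G : TopologicalGroup c ℓ} → KijimaNishi p G → KijimaNishiHom (𝔽 p) p G
KijimaNishi⇒KijimaNishiHom p = over⇒hom (𝔽 p) p

KijimaNishiHom⇒KijimaNishi : ∀ p {G : TopologicalGroup c ℓ} → KijimaNishiHom (𝔽 p) p G → KijimaNishi p G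
KijimaNishiHom⇒KijimaNishi p = hom⇒over (𝔽 p) p

-- Shapiro's lemma

-- The quotient group is transported to `Fin k` because `Wreath` takes a group with propositional
-- equality on the finite set of coordinates.
module CosetGroup {G : Group c ℓ} (U : Subgroup G s) (normal : Normal G U)
                  {k} (index : HasIndex U k) where
  private
    module Q = Group (quotient U normal)
    open Inverse index

  _·_ : Fin k → Fin k → Fin k
  a · b = to (from a Q.∙ from b)

  e : Fin k
  e = to Q.ε

  inv : Fin k → Fin k
  inv a = to (from a Q.⁻¹)

  abstract
    isGroup : IsGroup _≡_ _·_ e inv
    isGroup = GroupMonomorphism.isGroup {G₂ = Q.rawGroup} {⟦_⟧ = from} (record
      { isGroupHomomorphism = record
        { isMonoidHomomorphism = record
          { isMagmaHomomorphism = record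
            { isRelHomomorphism = record { cong = from-cong }
            ; homo = λ a b → strictlyInverseʳ (from a Q.∙ from b)
            }
          ; ε-homo = strictlyInverseʳ Q.ε
          }
        ; ⁻¹-homo = λ a → strictlyInverseʳ (from a Q.⁻¹)
        }
      ; injective = λ {a} {b} eq →
          ≡.trans (≡.sym (strictlyInverseˡ a)) (≡.trans (to-cong eq) (strictlyInverseˡ b))
      }) Q.isGroup

  to-homo : ∀ x y → to (x Q.∙ y) ≡ to x · to y
  to-homo x y = to-cong (Q.sym {from (to x) Q.∙ from (to y)} {x Q.∙ y}
    (Q.∙-cong {from (to x)} {x} {from (to y)} {y} (strictlyInverseʳ x) (strictlyInverseʳ y)))

module _ {H : TopologicalGroup c ℓ} where
  open TopologicalGroup H

  private
    module GP = GroupProperties group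

  conjugate-neighbourhood : ∀ {V} g → IsOpen V → V ε →
    ∃[ W ] IsOpen W × W ε × (∀ {x} → W x → V (g ∙ x ∙ g ⁻¹))
  conjugate-neighbourhood g oV Vε =
    let (W , _ , oW , _ , w , w′ , h) = ∙-cont (g ∙ ε) (g ⁻¹) oV
          (open-resp oV (sym (trans (∙-congʳ (identityʳ g)) (inverseʳ g))) Vε)
        (_ , X , _ , oX , v , x , h′) = ∙-cont g ε oW w
    in X , oX , x , λ y → h (h′ v y) w′

  finite-intersection : ∀ n (V : Fin n → Pred Carrier ℓ) → (∀ j → IsOpen (V j)) → (∀ j → V j ε) →
    ∃[ W ] IsOpen W × W ε × (∀ {x} → W x → ∀ j → V j x)
  finite-intersection zero V oV Vε = _ , open-⊤ , lift tt , λ _ ()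
  finite-intersection (suc n) V oV Vε =
    let (W , oW , w , h) = finite-intersection n (V ∘ suc) (oV ∘ suc) (Vε ∘ suc)
    in _ , open-∩ (oV zero) oW , (Vε zero , w) , λ (v , w′) → λ { zero → v ; (suc j) → h w′ j }

  module _ {k} {_·_ : Fin k → Fin k → Fin k} {e inv} (C : IsGroup _≡_ _·_ e inv) where
    open Wreath C

    -- The cosets are numbered by the values of `χ`, so that `to` is `χ` itself and the chosen
    -- preimages are the representatives. The caller thus controls which representatives enter the
    -- transfer.
    surjective⇒index : (χ : ContinuousHom H finGroup) → (∀ s → ∃[ x ] ContinuousHom.fun χ x ≡ s) →
                       HasIndex (kernel ℓ (ContinuousHom.homomorphism χ)) k
    surjective⇒index χ surjective = mkFinite fun (proj₁ ∘ surjective)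
      (λ (lift m) → //≈ε⇒≈ m) (proj₂ ∘ surjective)
      (λ x → lift (≈⇒//≈ε (proj₂ (surjective (fun x)))))
      where open ContinuousHom χ

  -- Shapiro's lemma in degree one: homomorphisms on U with values in P correspond to
  -- homomorphisms to P ≀ C above to, up to conjugation by the base group.
  module Shapiro (U : OpenSubgroup H) {k} (index : HasIndex (OpenSubgroup.subgroup U) k)
                 {_·_ : Fin k → Fin k → Fin k} {e inv} (C : IsGroup _≡_ _·_ e inv)
                 (to-homo : ∀ x y → Inverse.to index (x ∙ y) ≡ Inverse.to index x · Inverse.to index y)
    where
    open OpenSubgroup U
    open Inverse index using (to; from; to-cong; strictlyInverseˡ; strictlyInverseʳ)
    open Wreath C
    private
      module C = IsGroup C
      module UG = Group (subgroupGroup subgroup)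

      t : Fin k → Carrier → UG.Carrier
      t = transfer U index

    quotientMap : ContinuousHom H finGroup
    quotientMap = record
      { homomorphism = homomorphism
      ; locally-trivial = Mem , isOpen , ε-mem , λ {x} m → ≡.trans
          (to-cong (resp (sym (trans (∙-congˡ GP.ε⁻¹≈ε) (identityʳ x))) m)) (Homomorphism.ε-homo homomorphism)
      }
      where
      homomorphism : Homomorphism group finGroup
      homomorphism = record
        { fun = to ; cong = λ eq → to-cong (resp (sym (GP.x≈y⇒x∙y⁻¹≈ε eq)) ε-mem) ; homo = to-homo }

    private module χ = ContinuousHom quotientMap

    to-mem : ∀ {x} → Mem x → to x ≡ e
    to-mem = proj₂ (proj₂ (proj₂ χ.locally-trivial))

    to-from∙ : ∀ s x → to (from s ∙ x) ≡ s · to x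
    to-from∙ s x = ≡.trans (to-homo (from s) x) (≡.cong (_· to x) (strictlyInverseˡ s))

    transfer≈ : ∀ s x → proj₁ (t s x) ≈ from s ∙ x ∙ from (s · to x) ⁻¹
    transfer≈ s x = ∙-congˡ (⁻¹-cong (reflexive (≡.cong from (to-from∙ s x))))

    transfer-cong : ∀ s {x y} → x ≈ y → proj₁ (t s x) ≈ proj₁ (t s y)
    transfer-cong s eq = ∙-cong (∙-congˡ eq) (⁻¹-cong (reflexive (≡.cong from (χ.cong (∙-congˡ eq)))))

    -- This cocycle identity is what makes `induce` multiplicative: the second factor is evaluated
    -- at the coset moved by `x`, as in the wreath product.
    transfer-∙ : ∀ s x y → proj₁ (t s (x ∙ y)) ≈ proj₁ (t s x UG.∙ t (s · to x) y)
    transfer-∙ s x y = begin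
      proj₁ (t s (x ∙ y))                         ≈⟨ transfer≈ s (x ∙ y) ⟩
      a ∙ (x ∙ y) ∙ from (s · to (x ∙ y)) ⁻¹
        ≈⟨ ∙-congˡ (⁻¹-cong (reflexive (≡.cong from
             (≡.trans (≡.cong (s ·_) (to-homo x y)) (≡.sym (C.assoc s _ _)))))) ⟩
      a ∙ (x ∙ y) ∙ d ⁻¹                                 ≈⟨ ∙-congʳ (assoc a x y) ⟨
      a ∙ x ∙ y ∙ d ⁻¹                                   ≈⟨ ∙-congʳ (∙-congʳ (GP.//-rightDividesˡ b (a ∙ x))) ⟨
      a ∙ x ∙ b ⁻¹ ∙ b ∙ y ∙ d ⁻¹                        ≈⟨ ∙-congʳ (assoc _ b y) ⟩
      a ∙ x ∙ b ⁻¹ ∙ (b ∙ y) ∙ d ⁻¹                      ≈⟨ assoc _ (b ∙ y) (d ⁻¹) ⟩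
      a ∙ x ∙ b ⁻¹ ∙ (b ∙ y ∙ d ⁻¹)                      ≈⟨ ∙-cong (transfer≈ s x) (transfer≈ (s · to x) y) ⟨
      proj₁ (t s x UG.∙ t (s · to x) y)    ∎
      where
      open SetoidReasoning setoid
      a = from s
      b = from (s · to x)
      d = from ((s · to x) · to y)

    transfer-mem : ∀ s {x} → Mem x → proj₁ (t s x) ≈ from s ∙ x ∙ from s ⁻¹
    transfer-mem s {x} m = trans (transfer≈ s x) (∙-congˡ (⁻¹-cong (reflexive (≡.cong from
      (≡.trans (≡.cong (s ·_) (to-mem m)) (C.identityʳ s))))))

    module _ {P : Group 0ℓ 0ℓ} where
      private module P = Group P

      induce : ContinuousHom (openSubgroup U) P → ContinuousHom H (wreath P)
      induce β = record
        { homomorphism = record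
          { fun = λ x → (λ s → β.fun (t s x)) , to x
          ; cong = λ eq → (λ s → β.cong (transfer-cong s eq)) , χ.cong eq
          ; homo = λ x y →
              (λ s → P.trans (β.cong (transfer-∙ s x y)) (β.homo (t s x) (t (s · to x) y))) ,
              to-homo x y
          }
        ; locally-trivial =
            let (X , (_ , oX) , Xε , trivial) = β.locally-trivial
                -- On `U` the transfer at `s` is conjugation by `from s`, so the neighbourhood has
                -- to be pulled back along each of these finitely many conjugations.
                conj = λ s → conjugate-neighbourhood (from s) oX (ε-mem , Xε)
                (W , oW , Wε , h) = finite-intersection k (proj₁ ∘ conj)
                  (λ s → proj₁ (proj₂ (conj s))) (λ s → proj₁ (proj₂ (proj₂ (conj s))))
            in _ , open-∩ isOpen oW , (ε-mem , Wε) , λ (m , w) →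
               (λ s → let (n , v) = proj₂ (proj₂ (proj₂ (conj s))) (h w s)
                      in P.trans (β.cong {y = _ , n} (transfer-mem s m)) (trivial v)) ,
               to-mem m
        }
        where module β = ContinuousHom β

      module _ (B : ContinuousHom H (wreath P))
               (above : ∀ x → proj₂ (ContinuousHom.fun B x) ≡ to x) where
        private
          module B = ContinuousHom B
          f : Carrier → Fin k → P.Carrier
          f x = proj₁ (B.fun x)
          f-∙ : ∀ x y s → f (x ∙ y) s P.≈ f x s P.∙ f y (s · to x)
          f-∙ x y s = P.trans (proj₁ (B.homo x y) s)
            (P.∙-congˡ (P.reflexive (≡.cong (λ d → f y (s · d)) (above x))))

        -- Elements of `U` have trivial component in `C` and move no coordinate, so the coordinate
        -- at `e` is multiplicative on `U`.
        coinduce : ContinuousHom (openSubgroup U) P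
        coinduce = record
          { homomorphism = record
            { fun = λ (v , _) → f v e
            ; cong = λ eq → proj₁ (B.cong eq) e
            ; homo = λ (v , m) (w , _) → P.trans (f-∙ v w e) (P.∙-congˡ (P.reflexive
                (≡.cong (f w) (≡.trans (C.identityˡ (to v)) (to-mem m)))))
            }
          ; locally-trivial =
              let (V , oV , Vε , trivial) = B.locally-trivial
              in restrict U V , restrict-open U oV , Vε , λ v → proj₁ (trivial v) e
          }

        -- Hence `induce` after `coinduce` returns `B` conjugated by the element of the base group
        -- with coordinates `f (from s) e`. Conjugating back is `twist` with these coordinates.
        coinduce-transfer : ∀ s x → ContinuousHom.fun coinduce (t s x) P.≈
          f (from s) e P.∙ f x s P.∙ f (from (s · to x)) e P.⁻¹
        coinduce-transfer s x = begin
          f (proj₁ (t s x)) e                            ≈⟨ proj₁ (B.cong (transfer≈ s x)) e ⟩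
          f (from s ∙ x ∙ b ⁻¹) e                               ≈⟨ f-∙ (from s ∙ x) (b ⁻¹) e ⟩
          f (from s ∙ x) e P.∙ f (b ⁻¹) (e · to (from s ∙ x))   ≈⟨ P.∙-cong head tail ⟩
          f (from s) e P.∙ f x s P.∙ f b e P.⁻¹                 ∎
          where
          open SetoidReasoning P.setoid
          b = from (s · to x)
          head : f (from s ∙ x) e P.≈ f (from s) e P.∙ f x s
          head = P.trans (f-∙ (from s) x e) (P.∙-congˡ (P.reflexive (≡.cong (f x)
            (≡.trans (C.identityˡ _) (strictlyInverseˡ s)))))
          tail : f (b ⁻¹) (e · to (from s ∙ x)) P.≈ f b e P.⁻¹
          tail = P.trans (proj₁ (B.⁻¹-homo b) _) (P.⁻¹-cong (P.reflexive (≡.cong (f b)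
            (≡.trans (≡.cong₂ (λ t u → t · inv u)
              (≡.trans (C.identityˡ _) (to-from∙ s x)) (≡.trans (above b) (strictlyInverseˡ _)))
              (C.inverseʳ (s · to x))))))

      -- The representative `from e` of the trivial coset lies in `U` but need not be `ε`, so `γ` is
      -- evaluated at a conjugate of `v`. In a commutative group the conjugation disappears.
      coinduce-induce : (∀ x y → x P.∙ y P.≈ y P.∙ x) → ∀ (γ : ContinuousHom (openSubgroup U) P) v →
        proj₁ (ContinuousHom.fun (induce γ) (proj₁ v)) e P.≈ ContinuousHom.fun γ v
      coinduce-induce comm γ v = begin
        γ.fun (t e (proj₁ v))              ≈⟨ γ.cong {y = w UG.∙ v UG.∙ w UG.⁻¹} (transfer-mem e (proj₂ v)) ⟩
        γ.fun (w UG.∙ v UG.∙ w UG.⁻¹)             ≈⟨ γ.homo (w UG.∙ v) (w UG.⁻¹) ⟩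
        γ.fun (w UG.∙ v) P.∙ γ.fun (w UG.⁻¹)      ≈⟨ P.∙-cong (P.trans (γ.homo w v) (comm _ _)) (γ.⁻¹-homo w) ⟩
        γ.fun v P.∙ γ.fun w P.∙ γ.fun w P.⁻¹      ≈⟨ GroupProperties.//-rightDividesʳ P (γ.fun w) (γ.fun v) ⟩
        γ.fun v                                   ∎
        where
        open SetoidReasoning P.setoid
        module γ = ContinuousHom γ
        w : UG.Carrier
        w = from e , resp
          (trans (∙-congˡ GP.ε⁻¹≈ε) (identityʳ (from e)))
          (Setoid.trans (rightCosets subgroup) {from e} {from (to ε)} {ε}
            (≡.subst (λ t → Mem (from e ∙ from t ⁻¹)) (≡.sym χ.ε-homo) (resp (sym (inverseʳ (from e))) ε-mem))
            (strictlyInverseʳ ε))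

-- Preimages under the corestriction for one factor

module _ (A : CommutativeRing 0ℓ 0ℓ) where
  private module A = CommutativeRing A
  open Sums A.+-commutativeMonoid

  sum-single : ∀ {n} (i : Fin n) t → (∀ j → j ≢ i → t j A.≈ A.0#) → sum t A.≈ t i
  sum-single {suc n} i t vanish = A.trans (sum-remove {i = i} t) (A.trans (A.+-congˡ (A.trans
    (sum-cong-≋ λ j → vanish (punchIn i j) (Fin.punchInᵢ≢i i j)) (sum-replicate-zero n)))
    (A.+-identityʳ (t i)))

  -- It lifts every pair with first member zero.
  heisenberg-inclusion₂ : Homomorphism (additive A) (heisenberg A)
  heisenberg-inclusion₂ = record
    { fun = λ b → A.0# , b , A.0#
    ; cong = λ eq → A.refl , eq , A.refl
    ; homo = λ b b′ → A.sym (A.+-identityˡ A.0#) , A.refl ,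
        A.sym (A.trans (A.+-cong (A.+-identityˡ A.0#) (A.zeroˡ b′)) (A.+-identityˡ A.0#))
    }

module _ {k} {_·_ : Fin k → Fin k → Fin k} {e inv} (C : IsGroup _≡_ _·_ e inv)
         {H : TopologicalGroup c ℓ} where
  open Wreath C
  open TopologicalGroup H
  private module C = IsGroup C

  fromBase : ∀ {P} → (Fin k → ContinuousHom H P) → ContinuousHom H (wreath P)
  fromBase {P} f = record
    { homomorphism = record
      { fun = λ x → (λ s → f.fun s x) , e
      ; cong = λ eq → (λ s → f.cong s eq) , ≡.refl
      ; homo = λ x y →
          (λ s → P.trans (f.homo s x y) (P.∙-congˡ (P.reflexive
             (≡.cong (λ t → f.fun t y) (≡.sym (C.identityʳ s)))))) ,
          ≡.sym (C.identityˡ e)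
      }
    ; locally-trivial =
        let (W , oW , Wε , h) = finite-intersection {H = H} k (λ s → proj₁ (f.locally-trivial s))
              (λ s → proj₁ (proj₂ (f.locally-trivial s)))
              (λ s → proj₁ (proj₂ (proj₂ (f.locally-trivial s))))
        in W , oW , Wε , λ w → (λ s → proj₂ (proj₂ (proj₂ (f.locally-trivial s))) (h w s)) , ≡.refl
    }
    where
    module P = Group P
    module f s = ContinuousHom (f s)

  coordinate : ∀ {P} (B : ContinuousHom H (wreath P)) → (∀ x → proj₂ (ContinuousHom.fun B x) ≡ e) →
               Fin k → ContinuousHom H P
  coordinate {P} B inBase s = record
    { homomorphism = record
      { fun = λ x → proj₁ (B.fun x) s
      ; cong = λ eq → proj₁ (B.cong eq) s
      ; homo = λ x y → P.trans (proj₁ (B.homo x y) s) (P.∙-congˡ (P.reflexive (≡.cong (proj₁ (B.fun y))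
          (≡.trans (≡.cong (s ·_) (inBase x)) (C.identityʳ s)))))
      }
    ; locally-trivial =
        let (W , oW , Wε , trivial) = B.locally-trivial in W , oW , Wε , λ w → proj₁ (trivial w) s
    }
    where
    module P = Group P
    module B = ContinuousHom B

  module _ (A : CommutativeRing 0ℓ 0ℓ) where
    private module A = CommutativeRing A

    WreathLifts : (b b′ : ContinuousHom H (wreath (additive A))) → Set (c ⊔ lsuc ℓ)
    WreathLifts = LiftsAlong (wreath-map (heis₁ A)) (wreath-map (heis₂ A))

    -- Under Shapiro's lemma this says that the class on the kernel of H → C is in its radical.
    IsWreathRadical : ContinuousHom H (wreath (additive A)) → Set (c ⊔ lsuc ℓ)
    IsWreathRadical b = ∀ c → (∀ x → proj₂ (ContinuousHom.fun c x) ≡ proj₂ (ContinuousHom.fun b x)) →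
                        WreathLifts b c

    -- The last component serves the gluing: on almost all factors `χ` and `α` are both trivial, and
    -- `b` has to be trivial there as well.
    TransferPreimage : ContinuousHom H finGroup → ContinuousHom H (additive A) → Set (c ⊔ lsuc ℓ)
    TransferPreimage χ α = Σ (ContinuousHom H (wreath (additive A))) λ b →
      (∀ x → proj₂ (ContinuousHom.fun b x) ≡ ContinuousHom.fun χ x) ×
      (∀ x → Homomorphism.fun (wreath-sum A C) (ContinuousHom.fun b x) A.≈ ContinuousHom.fun α x) ×
      IsWreathRadical b ×
      ((∀ x → ContinuousHom.fun χ x ≡ e) → (∀ x → ContinuousHom.fun α x A.≈ A.0#) →
       ∀ x → Group._≈_ (wreath (additive A)) (ContinuousHom.fun b x) (Group.ε (wreath (additive A))))

    transferPreimage-trivial : (χ : ContinuousHom H finGroup) → (∀ x → ContinuousHom.fun χ x ≡ e) →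
      (α : ContinuousHom H (additive A)) → IsRadical A α → TransferPreimage χ α
    transferPreimage-trivial χ χ≡e α radical =
      fromBase atε , (λ x → ≡.sym (χ≡e x)) ,
      (λ x → A.trans (sum-single A e (λ s → ContinuousHom.fun (atε s) x) (λ s s≢e → off s≢e x)) (at-e x)) ,
      wreathRadical ,
      λ _ α≈0 x → (λ s → vanish s (s Fin.≟ e) x (α≈0 x)) , ≡.refl
      where
      choose : ∀ {P} → ContinuousHom H P → ContinuousHom H P → ∀ {s} → Dec (s ≡ e) → ContinuousHom H P
      choose f g (yes _) = f
      choose f g (no _)  = g

      atε : Fin k → ContinuousHom H (additive A)
      atε s = choose α (trivialHom (additive A)) (s Fin.≟ e)

      off : ∀ {s} → s ≢ e → ∀ x → ContinuousHom.fun (atε s) x A.≈ A.0#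
      off {s} s≢e x with s Fin.≟ e
      ... | yes s≡e = ⊥-elim (s≢e s≡e)
      ... | no _    = A.refl

      at-e : ∀ x → ContinuousHom.fun (atε e) x A.≈ ContinuousHom.fun α x
      at-e x with e Fin.≟ e
      ... | yes _  = A.refl
      ... | no e≢e = ⊥-elim (e≢e ≡.refl)

      vanish : ∀ s (d : Dec (s ≡ e)) x → ContinuousHom.fun α x A.≈ A.0# →
               ContinuousHom.fun (choose α (trivialHom (additive A)) d) x A.≈ A.0#
      vanish s (yes _) x α≈0 = α≈0
      vanish s (no _)  x _   = A.refl

      wreathRadical : IsWreathRadical (fromBase atε)
      wreathRadical c above = fromBase lift-at , λ x →
        ((λ s → proj₁ (spec s (s Fin.≟ e) x)) , ≡.refl) ,
        ((λ s → proj₂ (spec s (s Fin.≟ e) x)) , ≡.sym (above x))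
        where
        γ = coordinate c above
        Φ = radical (γ e)
        at : ∀ s → Dec (s ≡ e) → ContinuousHom H (heisenberg A)
        at s = choose (proj₁ Φ) (heisenberg-inclusion₂ A ∘ʰ γ s)
        lift-at : Fin k → ContinuousHom H (heisenberg A)
        lift-at s = at s (s Fin.≟ e)
        spec : ∀ s (d : Dec (s ≡ e)) x →
          proj₁ (ContinuousHom.fun (at s d) x) A.≈ ContinuousHom.fun (choose α (trivialHom (additive A)) d) x ×
          proj₁ (proj₂ (ContinuousHom.fun (at s d) x)) A.≈ ContinuousHom.fun (γ s) x
        spec s (yes ≡.refl) x = proj₂ Φ x
        spec s (no _)       x = A.refl , A.refl

    -- The kernel of `χ` has coset group `C`, with `to` equal to `χ`, so the coordinates of the
    -- induced homomorphism are literally the summands of the transfer sum. The last component is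
    -- vacuous because `χ` is nontrivial.
    transferPreimage-surjective : KijimaNishiHom A k H → (χ : ContinuousHom H finGroup) →
      (∀ s → ∃[ x ] ContinuousHom.fun χ x ≡ s) → ¬ (∀ x → ContinuousHom.fun χ x ≡ e) →
      (α : ContinuousHom H (additive A)) → IsRadical A α → TransferPreimage χ α
    transferPreimage-surjective kn χ surjective nontrivial α radical =
      S.induce {additive A} β , (λ _ → ≡.refl) , sum≈α , wreathRadical , λ χ≡e → ⊥-elim (nontrivial χ≡e)
      where
      U = ContinuousHom.kernelOpen χ
      index = surjective⇒index C χ surjective
      module S = Shapiro U index C (ContinuousHom.homo χ)
      solution = kn U (kernel-normal _ (ContinuousHom.homomorphism χ)) index α radical
      β = proj₁ solution
      β-radical = proj₁ (proj₂ solution)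
      sum≈α = proj₂ (proj₂ solution)

      wreathRadical : IsWreathRadical (S.induce {additive A} β)
      -- Inducing the lift of `β` and `coinduce c` gives the conjugate of `c` described by
      -- `coinduce-transfer`. Conjugation by `κ` undoes it; the first entry of `κ` is zero, so the
      -- part over `β` does not change.
      wreathRadical c above = twist (heisenberg A) κ ∘ʰ S.induce {heisenberg A} (proj₁ Φ) , λ x →
        ((λ s → A.trans
           (A.+-cong (A.trans (A.+-congʳ (GroupProperties.ε⁻¹≈ε A.+-group)) (A.+-identityˡ _)) A.refl)
           (A.trans (A.+-identityʳ _) (proj₁ (proj₂ Φ (transfer U index s x))))) , ≡.refl) ,
        ((λ s → begin
           A.- d s A.+ proj₁ (proj₂ (ContinuousHom.fun (proj₁ Φ) (transfer U index s x))) A.+ d (s · χ.fun x)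
             ≈⟨ A.+-congʳ (A.+-congˡ (A.trans (proj₂ (proj₂ Φ (transfer U index s x)))
                  (A.trans (S.coinduce-transfer {additive A} c above s x) (A.+-assoc _ _ _)))) ⟩
           A.- d s A.+ (d s A.+ (proj₁ (ContinuousHom.fun c x) s A.+ A.- d (s · χ.fun x))) A.+ d (s · χ.fun x)
             ≈⟨ A.+-congʳ (AP.\\-leftDividesʳ (d s) _) ⟩
           proj₁ (ContinuousHom.fun c x) s A.+ A.- d (s · χ.fun x) A.+ d (s · χ.fun x)
             ≈⟨ AP.//-rightDividesˡ (d (s · χ.fun x)) _ ⟩
           proj₁ (ContinuousHom.fun c x) s ∎) , ≡.sym (above x))
        where
        module χ = ContinuousHom χ
        module AP = GroupProperties A.+-group
        open SetoidReasoning A.setoid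
        Φ = β-radical (S.coinduce {additive A} c above)
        d : Fin k → A.Carrier
        d s = proj₁ (ContinuousHom.fun c (proj₁ (surjective s))) e
        κ : Fin k → Group.Carrier (heisenberg A)
        κ s = A.0# , d s , A.0#

-- Homomorphisms to a group of prime order

module _ (em : ∀ a → ExcludedMiddle a) {p} (p-prime : Prime p)
         {_·_ : Fin p → Fin p → Fin p} {e inv} (C : IsGroup _≡_ _·_ e inv)
         {H : TopologicalGroup c ℓ} where
  open Wreath C
  open Classical em
  private
    module C = IsGroup C
    module H = TopologicalGroup H

  -- By `lagrange` the index of the kernel times that of the image is the prime `p`, so one of them
  -- is 1.
  trivial-or-surjective : (χ : Homomorphism H.group finGroup) → let open Homomorphism χ in
    (∀ x → fun x ≡ e) ⊎ (∀ s → ∃[ x ] fun x ≡ s)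
  trivial-or-surjective χ = decide (proj₂ index) (proj₂ image-index)
    (Prime.prime⇒irreducible p-prime (ℕ∣.divides {proj₁ index} (proj₁ image-index)
      (≡.trans p≡mk (ℕ.*-comm (proj₁ index) (proj₁ image-index)))))
    p≡mk
    where
    open Homomorphism χ
    K = kernel 0ℓ χ
    card : Finite (Group.setoid finGroup) p
    card = mkFinite id id id (λ _ → ≡.refl) (λ _ → ≡.refl)
    index = index-kernel χ card K lower lift
    image-index = index-image χ card K lower lift
    p≡mk : p ≡ proj₁ index ℕ.* proj₁ image-index
    p≡mk = lagrange χ card K lower lift

    fin1 : ∀ (i j : Fin 1) → i ≡ j
    fin1 zero zero = ≡.refl

    -- The indices are variables here so that matching on their equations can replace them.
    decide : ∀ {m k} → HasIndex K m → HasIndex (imageSubgroup χ) k → m ≡ 1 ⊎ m ≡ p → p ≡ m ℕ.* k →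
             (∀ x → fun x ≡ e) ⊎ (∀ s → ∃[ x ] fun x ≡ s)
    decide κ ρ (inj₁ ≡.refl) _ = inj₁ λ x → ≡.trans
      (//≈ε⇒≈ {x} {H.ε} (lower (Setoid.trans (rightCosets K) {x} {κ.from (κ.to x)} {H.ε}
        (Setoid.sym (rightCosets K) {κ.from (κ.to x)} {x} (κ.strictlyInverseʳ x))
        (≡.subst (λ i → Subgroup.Mem K (κ.from i H.∙ H.ε H.⁻¹)) (fin1 (κ.to H.ε) (κ.to x))
          (κ.strictlyInverseʳ H.ε)))))
      ε-homo
      where module κ = Inverse κ
    decide {k = k} κ ρ (inj₂ ≡.refl) p≡pk with ℕ.*-cancelˡ-≡ k 1 p {{Prime.prime⇒nonZero p-prime}}
                                       (≡.trans (≡.sym p≡pk) (≡.sym (ℕ.*-identityʳ p)))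
    ... | ≡.refl = inj₂ λ s →
      let (x , fx≡s/e) = Setoid.trans (rightCosets (imageSubgroup χ)) {s} {ρ.from (ρ.to s)} {e}
            (Setoid.sym (rightCosets (imageSubgroup χ)) {ρ.from (ρ.to s)} {s} (ρ.strictlyInverseʳ s))
            (≡.subst (λ i → Subgroup.Mem (imageSubgroup χ) (ρ.from i · inv e)) (fin1 (ρ.to e) (ρ.to s))
              (ρ.strictlyInverseʳ e))
      in x , ≡.trans fx≡s/e (≡.trans (≡.cong (s ·_) (GroupProperties.ε⁻¹≈ε finGroup)) (C.identityʳ s))
      where module ρ = Inverse ρ

  transferPreimage : ∀ A → KijimaNishiHom A p H → (χ : ContinuousHom H finGroup) →
    (α : ContinuousHom H (additive A)) → IsRadical A α → TransferPreimage C {H} A χ α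
  -- Triviality is decided first, because the surjective case takes its negation as a hypothesis.
  transferPreimage A kn χ α radical = cases (em _) (trivial-or-surjective (ContinuousHom.homomorphism χ))
    where
    open ContinuousHom χ using (fun)
    cases : Dec (∀ x → fun x ≡ e) → (∀ x → fun x ≡ e) ⊎ (∀ s → ∃[ x ] fun x ≡ s) →
            TransferPreimage C {H} A χ α
    cases (yes χ≡e) _                 = transferPreimage-trivial C {H} A χ χ≡e α radical
    cases (no χ≢e)  (inj₁ χ≡e)        = ⊥-elim (χ≢e χ≡e)
    cases (no χ≢e)  (inj₂ surjective) = transferPreimage-surjective C {H} A kn χ surjective χ≢e α radical

-- The universal property of the free pro-p product

open import Data.List.Base using ([]; _∷_; _++_; [_])
open import Data.List.Membership.Propositional using (_∉_)
open import Data.List.Membership.Propositional.Properties using (∈-++⁺ˡ; ∈-++⁺ʳ)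
open import Data.List.Relation.Unary.All as All using (All; []; _∷_)
open import Data.List.Relation.Unary.Any using (here)

-- The universal property of G as the free pro-p product of the H j, for targets that are
-- finite p-groups.
record IsFreeProPProduct (p : ℕ) {I : Set i} (H : I → TopologicalGroup c ℓ)
                         (G : TopologicalGroup c′ ℓ′) : Set (i ⊔ lsuc 0ℓ ⊔ c ⊔ lsuc ℓ ⊔ c′ ⊔ lsuc ℓ′) where
  private
    module H j = TopologicalGroup (H j)
    module G = TopologicalGroup G
  field
    ι            : ∀ j → Homomorphism (H.group j) G.group
  module ι j = Homomorphism (ι j)
  field
    ι-continuous : ∀ j → ContinuousAtε {H = H j} {G = G} (ι j)
    ι-almost-all : ∀ {V} → G.IsOpen V → V G.ε → ∃[ js ] ∀ j → j ∉ js → ∀ x → V (ι.fun j x)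
    extend       : ∀ {Q} → PPowerOrder p Q → (b : ∀ j → ContinuousHom (H j) Q) →
                   (∃[ js ] ∀ j → j ∉ js → ∀ x → Group._≈_ Q (ContinuousHom.fun (b j) x) (Group.ε Q)) →
                   Σ (ContinuousHom G Q) λ Φ → ∀ j x →
                     Group._≈_ Q (ContinuousHom.fun Φ (ι.fun j x)) (ContinuousHom.fun (b j) x)
    extensional  : ∀ {Q} (Φ Ψ : ContinuousHom G Q) →
                   (∀ j x → Group._≈_ Q (ContinuousHom.fun Φ (ι.fun j x)) (ContinuousHom.fun Ψ (ι.fun j x))) →
                   ∀ x → Group._≈_ Q (ContinuousHom.fun Φ x) (ContinuousHom.fun Ψ x)

-- Admissible subgroups and their inverse limit

module _ (em : ∀ a → ExcludedMiddle a) (p : ℕ) (p-prime : Prime p)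
         {I : Set i} (𝒢 : I → ProPGroup p c ℓ) where
  open Classical em
  private
    module 𝒢 j = ProPGroup (𝒢 j)
    open FreeProduct 𝒢.group
    module W = Group freeProduct
    𝒩 = AdmissibleSubgroup p 𝒢
    module 𝒩 = AdmissibleSubgroup
    module Q (N : 𝒩) = Group (quotient (𝒩.subgroup N) (𝒩.normal N))
    L = freeProPProduct p 𝒢
    module L = TopologicalGroup L

  -- By `lagrange` the index divides the order of `B`, and divisors of a power of `p` are powers of
  -- `p`.
  p-power-index : ∀ {s b ℓ₂} {B : Group b ℓ₂} (f : Homomorphism freeProduct B) → PPowerOrder p B →
                  (K : Subgroup freeProduct s) → let open Subgroup K in
                  (∀ {x} → Mem x → Group._≈_ B (Homomorphism.fun f x) (Group.ε B)) →
                  (∀ {x} → Group._≈_ B (Homomorphism.fun f x) (Group.ε B) → Mem x) →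
                  ∃[ n ] HasIndex K (p ^ n)
  p-power-index f (n , card) K K⇒ker ker⇒K =
    let (m , index) = index-kernel f card K K⇒ker ker⇒K
        (k , _) = index-image f card K K⇒ker ker⇒K
        (d , m≡p^d) = prime-power-divisor p-prime n
          (ℕ∣.divides {m} k (≡.trans (lagrange f card K K⇒ker ker⇒K) (ℕ.*-comm m k)))
    in d , ≡.subst (HasIndex K) m≡p^d index

  -- The index is a power of `p` because the intersection is the kernel of the diagonal map to the
  -- product of the two quotients. Equality with the unit in a quotient unfolds to membership of
  -- `x ++ []`, which `//[]` corrects.
  _∩ᴬ_ : 𝒩 → 𝒩 → 𝒩
  M ∩ᴬ N = record
    { subgroup     = K
    ; normal       = λ g (m , n) → M.normal g m , N.normal g n
    ; p-power      = p-power-index {B = B} diagonal order K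
        (λ {x} (m , n) → M.resp (∼-sym (//[] x)) m , N.resp (∼-sym (//[] x)) n)
        (λ {x} (m , n) → M.resp (//[] x) m , N.resp (//[] x) n)
    ; factors-open = λ j → 𝒢.open-∩ j (M.factors-open j) (N.factors-open j)
    ; almost-all   =
        let (js , h) = M.almost-all
            (ks , h′) = N.almost-all
        in js ++ ks , λ j j∉ x → h j (j∉ ∘ ∈-++⁺ˡ) x , h′ j (j∉ ∘ ∈-++⁺ʳ js) x
    }
    where
    module M = AdmissibleSubgroup M
    module N = AdmissibleSubgroup N
    K : Subgroup freeProduct _
    K = record
      { Mem       = λ w → M.Mem w × N.Mem w
      ; resp      = λ e (m , n) → M.resp e m , N.resp e n
      ; ε-mem     = M.ε-mem , N.ε-mem
      ; ∙-closed  = λ (m , n) (m′ , n′) → M.∙-closed m m′ , N.∙-closed n n′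
      ; ⁻¹-closed = λ (m , n) → M.⁻¹-closed m , N.⁻¹-closed n
      }
    B = DirectProduct.group (quotient M.subgroup M.normal) (quotient N.subgroup N.normal)
    module B = Group B
    //[] : ∀ x → x ++ [] ∼ x
    //[] x = W.identityʳ x
    diagonal : Homomorphism freeProduct B
    diagonal = record
      { fun = λ w → w , w
      ; cong = λ e → M.resp (W.sym (GroupProperties.x≈y⇒x∙y⁻¹≈ε freeProduct e)) M.ε-mem ,
                     N.resp (W.sym (GroupProperties.x≈y⇒x∙y⁻¹≈ε freeProduct e)) N.ε-mem
      ; homo = λ x y → B.refl {x ++ y , x ++ y}
      }
    order : PPowerOrder p B
    order =
      let (m , index) = M.p-power
          (n , index′) = N.p-power
      in m ℕ.+ n , ≡.subst (Finite B.setoid) (≡.sym (ℕ.^-distribˡ-+-* p m n)) (×-finite index index′)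

  whole : 𝒩
  whole = record
    { subgroup     = record
      { Mem = λ _ → Lift ℓ ⊤ ; resp = λ _ _ → _ ; ε-mem = _ ; ∙-closed = λ _ _ → _ ; ⁻¹-closed = λ _ → _ }
    ; normal       = λ _ _ → _
    ; p-power      = 0 , mkFinite (λ _ → zero) (λ _ → []) (λ _ → ≡.refl)
                           (λ { zero → ≡.refl ; (suc ()) }) (λ _ → _)
    ; factors-open = λ j → 𝒢.open-⊤ j
    ; almost-all   = [] , λ _ _ _ → _
    }

  lower-bound : ∀ Ns → Σ 𝒩 λ N → All (λ M → ∀ {w} → 𝒩.Mem N w → 𝒩.Mem M w) Ns
  lower-bound [] = whole , []
  lower-bound (M ∷ Ns) =
    let (N , h) = lower-bound Ns
    in M ∩ᴬ N , proj₁ ∷ All.map (λ h′ {w} m → h′ {w} (proj₂ m)) h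

  constant : Homomorphism freeProduct L.group
  constant = record
    { fun  = λ w → (λ _ → w) , λ {M} _ → Q.refl M {w}
    ; cong = λ e N → 𝒩.resp N (W.sym (GroupProperties.x≈y⇒x∙y⁻¹≈ε freeProduct e)) (𝒩.ε-mem N)
    ; homo = λ u v N → Q.refl N {u ++ v}
    }

  module _ {Q} (b : ∀ j → ContinuousHom (𝒢.topologicalGroup j) Q) where
    private
      module Tgt = Group Q
      module b j = ContinuousHom (b j)

    evaluate : Word → Tgt.Carrier
    evaluate []            = Tgt.ε
    evaluate ((j , x) ∷ w) = b.fun j x Tgt.∙ evaluate w

    evaluate-++ : ∀ u v → evaluate (u ++ v) Tgt.≈ evaluate u Tgt.∙ evaluate v
    evaluate-++ []            v = Tgt.sym (Tgt.identityˡ _)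
    evaluate-++ ((j , x) ∷ u) v = Tgt.trans (Tgt.∙-congˡ (evaluate-++ u v)) (Tgt.sym (Tgt.assoc _ _ _))

    evaluate-cong : ∀ {u v} → u ∼ v → evaluate u Tgt.≈ evaluate v
    evaluate-cong ∼-refl        = Tgt.refl
    evaluate-cong (∼-sym e)     = Tgt.sym (evaluate-cong e)
    evaluate-cong (∼-trans e f) = Tgt.trans (evaluate-cong e) (evaluate-cong f)
    evaluate-cong (++-cong {u} {u′} {v} {v′} e f) = Tgt.trans (evaluate-++ u v)
      (Tgt.trans (Tgt.∙-cong (evaluate-cong e) (evaluate-cong f)) (Tgt.sym (evaluate-++ u′ v′)))
    evaluate-cong (letter j e)  = Tgt.∙-congʳ (b.cong j e)
    evaluate-cong (unit j)      = Tgt.trans (Tgt.identityʳ _) (b.ε-homo j)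
    evaluate-cong (mult j x y)  = Tgt.trans (Tgt.sym (Tgt.assoc _ _ _)) (Tgt.∙-congʳ (Tgt.sym (b.homo j x y)))

    evaluation : Homomorphism freeProduct Q
    evaluation = record { fun = evaluate ; cong = evaluate-cong ; homo = evaluate-++ }

    module _ (order : PPowerOrder p Q)
             (almost-trivial : ∃[ js ] ∀ j → j ∉ js → ∀ x → b.fun j x Tgt.≈ Tgt.ε) where

      -- Being admissible, it is one of the indices of the limit, so every thread has a coordinate
      -- there.
      evaluation-kernel : 𝒩
      evaluation-kernel = record
        { subgroup     = kernel ℓ evaluation
        ; normal       = kernel-normal ℓ evaluation
        ; p-power      = p-power-index evaluation order (kernel ℓ evaluation) lower lift
        ; factors-open = λ j → 𝒢.open-ext j
            (λ (lift e) → lift (Tgt.trans (Tgt.identityʳ _) e))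
            (λ (lift e) → lift (Tgt.trans (Tgt.sym (Tgt.identityʳ _)) e))
            (b.fiber-open j Tgt.ε)
        ; almost-all   = proj₁ almost-trivial , λ j j∉ x →
            lift (Tgt.trans (Tgt.identityʳ _) (proj₂ almost-trivial j j∉ x))
        }

      -- The coordinate of a thread at `evaluation-kernel` is a word determined up to that kernel,
      -- so its value is well defined.
      extension : ContinuousHom L Q
      extension = record
        { homomorphism = record
          { fun = λ (x , _) → evaluate (x evaluation-kernel)
          ; cong = λ {x} {y} e → Homomorphism.//≈ε⇒≈ evaluation
              {proj₁ x evaluation-kernel} {proj₁ y evaluation-kernel} (lower (e evaluation-kernel))
          ; homo = λ (x , _) (y , _) → evaluate-++ (x evaluation-kernel) (y evaluation-kernel)
          }
        ; locally-trivial = Cylinder (quotients p 𝒢) [ evaluation-kernel ] L.ε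
            , cylinder-open (quotients p 𝒢) [ evaluation-kernel ] L.ε
            , cylinder-self (quotients p 𝒢) [ evaluation-kernel ] L.ε
            , λ { {x} (lift e ∷ []) →
                Tgt.sym (Homomorphism.//≈ε⇒≈ evaluation {[]} {proj₁ x evaluation-kernel} e) }
        }

  factor : ∀ j → Homomorphism (𝒢.group j) L.group
  factor j = record
    { fun  = λ x → fun (ι j x)
    ; cong = λ e → cong (letter j e)
    ; homo = λ x y → L.trans {fun (ι j (𝒢._∙_ j x y))} {fun (ι j x ++ ι j y)} {fun (ι j x) L.∙ fun (ι j y)}
        (cong (∼-sym (mult j x y))) (homo (ι j x) (ι j y))
    }
    where open Homomorphism constant

  private
    factor-cylinder : ∀ j Ns → ∃[ W ] 𝒢.IsOpen j W × W (𝒢.ε j) ×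
                      (∀ {x} → W x → Cylinder (quotients p 𝒢) Ns L.ε (Homomorphism.fun (factor j) x))
    factor-cylinder j [] = _ , 𝒢.open-⊤ j , _ , λ _ → []
    factor-cylinder j (N ∷ Ns) =
      let (W , oW , Wε , h) = factor-cylinder j Ns
      in _ , 𝒢.open-∩ j (𝒩.factors-open N j) oW ,
         -- A cylinder around `ε` asks for the quotient of `ε` by the point, hence for the inverse
         -- of the letter.
         (𝒩.resp N (∼-sym (unit j)) (𝒩.ε-mem N) , Wε) , λ (n , w) → 𝒩.⁻¹-closed N n ∷ h w

    almost-all-cylinder : ∀ Ns → ∃[ js ] ∀ j → j ∉ js → ∀ x →
                          Cylinder (quotients p 𝒢) Ns L.ε (Homomorphism.fun (factor j) x)
    almost-all-cylinder [] = [] , λ _ _ _ → []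
    almost-all-cylinder (N ∷ Ns) =
      let (js , h) = 𝒩.almost-all N
          (ks , h′) = almost-all-cylinder Ns
      in js ++ ks , λ j j∉ x → 𝒩.⁻¹-closed N (h j (j∉ ∘ ∈-++⁺ˡ) x) ∷ h′ j (j∉ ∘ ∈-++⁺ʳ js) x

  -- Density of the constant threads, from directedness of the admissible subgroups.
  dense : ∀ {V} → L.IsOpen V → V L.ε → ∀ x →
          ∃[ w ] V (x L.∙ Homomorphism.fun constant w L.⁻¹)
  dense oV Vε x =
    let (Ns , h) = oV L.ε Vε
        (N , below) = lower-bound Ns
        w = proj₁ x N
    in w , h {x L.∙ Homomorphism.fun constant w L.⁻¹}
         (All.map {P = λ M → ∀ {u} → 𝒩.Mem N u → 𝒩.Mem M u} (λ {M} N⊆M →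
         Q.sym M {proj₁ x M ++ inv w} {[]} (Q.trans M {proj₁ x M ++ inv w} {w ++ inv w} {[]}
           (Q.∙-cong M {proj₁ x M} {w} {inv w} {inv w}
             (Q.sym M {w} {proj₁ x M} (proj₂ x {M} {N} (λ {u} → N⊆M {u}))) (Q.refl M {inv w}))
           (Q.inverseʳ M w))) below)

  freeProPProduct-isFree : IsFreeProPProduct p 𝒢.topologicalGroup L
  freeProPProduct-isFree = record
    { ι = factor
    ; ι-continuous = λ j oV Vε →
        let (Ns , h) = oV L.ε Vε
            (W , oW , Wε , h′) = factor-cylinder j Ns
        in W , oW , Wε , λ {x} w → h {Homomorphism.fun (factor j) x} (h′ w)
    ; ι-almost-all = λ oV Vε →
        let (Ns , h) = oV L.ε Vε
            (js , h′) = almost-all-cylinder Ns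
        in js , λ j j∉ x → h {Homomorphism.fun (factor j) x} (h′ j j∉ x)
    ; extend = λ {Q} order b almost-trivial →
        extension b order almost-trivial , λ j x → Group.identityʳ Q _
    ; extensional = λ {Q} Φ Ψ agree x →
        let module P = Group Q
            module Φ = ContinuousHom Φ
            module Ψ = ContinuousHom Ψ
            -- By density some word agrees with `x` up to an element on which both homomorphisms are
            -- trivial.
            (V , oV , Vε , trivial) = common-neighbourhood Φ Ψ
            (w , v) = dense oV Vε x
            κw = Homomorphism.fun constant w
        in P.trans (Φ.//≈ε⇒≈ {x} {κw} (proj₁ (trivial v)))
             (P.trans (agree-on-words Φ Ψ agree w) (P.sym (Ψ.//≈ε⇒≈ {x} {κw} (proj₂ (trivial v)))))
    }
    where
    agree-on-words : ∀ {Q} (Φ Ψ : ContinuousHom L Q) →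
      (∀ j x → Group._≈_ Q (ContinuousHom.fun Φ (Homomorphism.fun (factor j) x))
                           (ContinuousHom.fun Ψ (Homomorphism.fun (factor j) x))) →
      ∀ w → Group._≈_ Q (ContinuousHom.fun Φ (Homomorphism.fun constant w))
                        (ContinuousHom.fun Ψ (Homomorphism.fun constant w))
    agree-on-words {Q} Φ Ψ agree [] = P.trans (at-ε Φ) (P.sym (at-ε Ψ))
      where
      module P = Group Q
      at-ε : ∀ (Φ : ContinuousHom L Q) → let module Φ = ContinuousHom Φ in
             Φ.fun (Homomorphism.fun constant []) P.≈ P.ε
      at-ε Φ = P.trans (Φ.cong {Homomorphism.fun constant []} {L.ε} (Homomorphism.ε-homo constant)) Φ.ε-homo
        where module Φ = ContinuousHom Φ
    agree-on-words {Q} Φ Ψ agree ((j , x) ∷ w) =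
      P.trans (split Φ) (P.trans (P.∙-cong (agree j x) (agree-on-words Φ Ψ agree w)) (P.sym (split Ψ)))
      where
      module P = Group Q
      κ = Homomorphism.fun constant
      split : ∀ (Φ : ContinuousHom L Q) → let module Φ = ContinuousHom Φ in
              Φ.fun (κ ((j , x) ∷ w)) P.≈ Φ.fun (κ (ι j x)) P.∙ Φ.fun (κ w)
      split Φ = P.trans (Φ.cong {κ ((j , x) ∷ w)} {κ (ι j x) L.∙ κ w} (Homomorphism.homo constant (ι j x) w))
                        (Φ.homo (κ (ι j x)) (κ w))
        where module Φ = ContinuousHom Φ

-- The two implications

module FreeProPProduct (em : ∀ a → ExcludedMiddle a) {p : ℕ} (p-prime : Prime p)
                       {I : Set i} {H : I → TopologicalGroup c ℓ} {G : TopologicalGroup c′ ℓ′}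
                       (free : IsFreeProPProduct p H G) where
  open IsFreeProPProduct free
  private
    module H j = TopologicalGroup (H j)
    module G = TopologicalGroup G
    open ContinuousHom using () renaming (fun to infix 9 _⟨_⟩)

  pullback : ∀ {P} j → ContinuousHom G P → ContinuousHom (H j) P
  pullback j = precompose (ι j) (ι-continuous j)

  module _ {P : Group 0ℓ 0ℓ} where
    private module P = Group P

    only : ∀ {j k} → Dec (j ≡ k) → ContinuousHom (H j) P → ContinuousHom (H k) P
    only (yes ≡.refl) γ = γ
    only (no _)       γ = trivialHom P

    only-off : ∀ {j k} (d : Dec (j ≡ k)) γ → j ≢ k → ∀ x → only d γ ⟨ x ⟩ P.≈ P.ε
    only-off (yes j≡k) γ j≢k x = ⊥-elim (j≢k j≡k)
    only-off (no _)    γ j≢k x = P.refl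

    only-on : ∀ {j} (d : Dec (j ≡ j)) γ x → only d γ ⟨ x ⟩ P.≈ γ ⟨ x ⟩
    only-on (yes ≡.refl) γ x = P.refl
    only-on (no j≢j)     γ x = ⊥-elim (j≢j ≡.refl)

    abstract
      extendTrivially : PPowerOrder p P → ∀ j (γ : ContinuousHom (H j) P) →
        Σ (ContinuousHom G P) λ Φ → (∀ x → Φ ⟨ ι.fun j x ⟩ P.≈ γ ⟨ x ⟩) ×
          (∀ k → j ≢ k → ∀ x → Φ ⟨ ι.fun k x ⟩ P.≈ P.ε)
      extendTrivially order j γ =
        let (Φ , spec) = extend order (λ k → only (em _ {j ≡ k}) γ)
              ([ j ] , λ k k∉ → only-off (em _) γ (λ j≡k → k∉ (here (≡.sym j≡k))))
        in Φ , (λ x → P.trans (spec j x) (only-on (em _) γ x)) ,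
           λ k j≢k x → P.trans (spec k x) (only-off (em _) γ j≢k x)

  module _ {Q P₁ P₂ : Group 0ℓ 0ℓ} (order : PPowerOrder p Q) (π₁ : Homomorphism Q P₁) (π₂ : Homomorphism Q P₂)
           (B : ContinuousHom G P₁) (Γ : ContinuousHom G P₂) where
    private
      module Q = Group Q
      module P₁ = Group P₁
      module P₂ = Group P₂

      Trivial : I → Set _
      Trivial j = ∀ x → B ⟨ ι.fun j x ⟩ P₁.≈ P₁.ε × Γ ⟨ ι.fun j x ⟩ P₂.≈ P₂.ε

      LocalLift : I → Set _
      LocalLift j = LiftsAlong π₁ π₂ (pullback j B) (pullback j Γ)

      -- Arbitrary local lifts of trivial data could be nontrivial on infinitely many factors and
      -- could not be glued. They are replaced by the trivial lift wherever both `B` and `Γ` are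
      -- trivial.
      choose : ∀ {j} → Dec (Trivial j) → LocalLift j → LocalLift j
      choose (yes trivial) _ = trivialHom Q , λ x →
        P₁.trans (Homomorphism.ε-homo π₁) (P₁.sym (proj₁ (trivial x))) ,
        P₂.trans (Homomorphism.ε-homo π₂) (P₂.sym (proj₂ (trivial x)))
      choose (no _) local = local

      choose-trivial : ∀ {j} (d : Dec (Trivial j)) local → Trivial j →
                       ∀ x → proj₁ (choose d local) ⟨ x ⟩ Q.≈ Q.ε
      choose-trivial (yes _)  local trivial x = Q.refl
      choose-trivial (no ¬tr) local trivial x = ⊥-elim (¬tr trivial)

    -- This plays the role of the injectivity of restriction to the factors on second cohomology.
    lift-factorwise : (∀ j → LocalLift j) → LiftsAlong π₁ π₂ B Γ
    lift-factorwise lifts =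
      let (V , oV , Vε , near) = common-neighbourhood B Γ
          (js , almost) = ι-almost-all oV Vε
          (Φ , spec) = extend order (proj₁ ∘ chosen)
            (js , λ j j∉ → choose-trivial (em _) (lifts j) (λ x → near (almost j j∉ x)))
      in Φ , λ x →
        extensional (π₁ ∘ʰ Φ) B (λ j y →
          P₁.trans (Homomorphism.cong π₁ (spec j y)) (proj₁ (proj₂ (chosen j) y))) x ,
        extensional (π₂ ∘ʰ Φ) Γ (λ j y →
          P₂.trans (Homomorphism.cong π₂ (spec j y)) (proj₂ (proj₂ (chosen j) y))) x
      where
      chosen : ∀ j → LocalLift j
      chosen j = choose (em _) (lifts j)

  module _ (A : CommutativeRing 0ℓ 0ℓ) (A-order : PPowerOrder p (additive A))
           (heis-order : PPowerOrder p (heisenberg A)) where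
    private module A = CommutativeRing A

    -- Every `γ` on the factor is the restriction of one on the product, where a lift exists and can
    -- be restricted.
    pullback-radical : ∀ j {α} → IsRadical A α → IsRadical A (pullback j α)
    pullback-radical j radical γ =
      let (γ̂ , spec , _) = extendTrivially A-order j γ
          (Φ , lifts) = radical γ̂
      in pullback j Φ , λ x → proj₁ (lifts (ι.fun j x)) , A.trans (proj₂ (lifts (ι.fun j x))) (spec x)

    factors⇒product : (∀ j → KijimaNishiHom A p (H j)) → KijimaNishiHom A p G
    factors⇒product kn U normal index α radical =
      β , β-radical , λ x → A.trans (transfer-cancel x) (sum≈α x)
      where
      open CosetGroup (OpenSubgroup.subgroup U) normal index
      open Wreath isGroup
      open Sums A.+-commutativeMonoid
      open Inverse index using (to; from)
      module S = Shapiro U index isGroup to-homo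
      module WA = Group (wreath (additive A))

      local : ∀ j → TransferPreimage isGroup A (pullback j S.quotientMap) (pullback j α)
      local j = transferPreimage em p-prime isGroup A (kn j) (pullback j S.quotientMap) (pullback j α)
                  (pullback-radical j {α} radical)

      global : Σ (ContinuousHom G (wreath (additive A))) λ Φ →
               ∀ j x → Φ ⟨ ι.fun j x ⟩ WA.≈ proj₁ (local j) ⟨ x ⟩
      global =
        let (V , oV , Vε , near) = common-neighbourhood S.quotientMap α
            (js , almost) = ι-almost-all oV Vε
        -- Outside `js` the quotient map and `α` vanish on the factor, so the last component of
        -- `local j` applies.
        in extend (wreath-order {P = additive A} ≡.refl A-order) (proj₁ ∘ local) (js , λ j j∉ →
             proj₂ (proj₂ (proj₂ (proj₂ (local j)))) (λ x → proj₁ (near (almost j j∉ x)))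
                                                     (λ x → proj₂ (near (almost j j∉ x))))

      B : ContinuousHom G (wreath (additive A))
      B = proj₁ global

      above : ∀ x → proj₂ (B ⟨ x ⟩) ≡ to x
      above = extensional (wreath-proj (additive A) ∘ʰ B) S.quotientMap λ j x →
        ≡.trans (proj₂ (proj₂ global j x)) (proj₁ (proj₂ (local j)) x)

      sum≈α : ∀ x → Homomorphism.fun (wreath-sum A isGroup) (B ⟨ x ⟩) A.≈ α ⟨ x ⟩
      sum≈α = extensional (wreath-sum A isGroup ∘ʰ B) α λ j x → A.trans
        (Homomorphism.cong (wreath-sum A isGroup) (proj₂ global j x)) (proj₁ (proj₂ (proj₂ (local j))) x)

      β : ContinuousHom (openSubgroup U) (additive A)
      β = S.coinduce {additive A} B above

      -- The conjugating terms of `coinduce-transfer` sum to `sum d` with both signs, since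
      -- translation by `to x` permutes the cosets.
      transfer-cancel : ∀ x → transferSum U index A β x A.≈ sum (proj₁ (B ⟨ x ⟩))
      transfer-cancel x = GroupProperties.∙-cancelʳ A.+-group (sum d) _ _ (begin
        sum (λ s → β ⟨ transfer U index s x ⟩) A.+ sum d
          ≈⟨ A.+-congˡ (sum-translate A isGroup d (to x)) ⟨
        sum (λ s → β ⟨ transfer U index s x ⟩) A.+ sum (λ s → d (s · to x))
          ≈⟨ ∑-distrib-+ (λ s → β ⟨ transfer U index s x ⟩) (λ s → d (s · to x)) ⟨
        sum (λ s → β ⟨ transfer U index s x ⟩ A.+ d (s · to x))
          ≈⟨ sum-cong-≋ (λ s → begin
               β ⟨ transfer U index s x ⟩ A.+ d (s · to x)
                 ≈⟨ A.+-congʳ (S.coinduce-transfer {additive A} B above s x) ⟩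
               d s A.+ proj₁ (B ⟨ x ⟩) s A.+ A.- d (s · to x) A.+ d (s · to x)
                 ≈⟨ GroupProperties.//-rightDividesˡ A.+-group (d (s · to x)) _ ⟩
               d s A.+ proj₁ (B ⟨ x ⟩) s
                 ≈⟨ A.+-comm _ _ ⟩
               proj₁ (B ⟨ x ⟩) s A.+ d s ∎) ⟩
        sum (λ s → proj₁ (B ⟨ x ⟩) s A.+ d s)
          ≈⟨ ∑-distrib-+ (proj₁ (B ⟨ x ⟩)) d ⟩
        sum (proj₁ (B ⟨ x ⟩)) A.+ sum d ∎)
        where
        open SetoidReasoning A.setoid
        d : Fin p → A.Carrier
        d s = proj₁ (B ⟨ from s ⟩) e

      -- Inducing carries `γ` to the whole group, where the lifts on the factors are glued; the
      -- coordinate at `e` of the result is the lift on `U`. Its first entry is `β` directly, since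
      -- `β` is itself coinduced from `B`.
      β-radical : IsRadical A β
      β-radical γ =
        let Γ = S.induce {additive A} γ
            (Φ , lifts) = lift-factorwise (wreath-order {P = heisenberg A} ≡.refl heis-order)
              (wreath-map (heis₁ A)) (wreath-map (heis₂ A)) B Γ λ j →
              let (Φⱼ , liftsⱼ) = proj₁ (proj₂ (proj₂ (proj₂ (local j)))) (pullback j Γ)
                                    (λ x → ≡.sym (proj₁ (proj₂ (local j)) x))
              in Φⱼ , λ x → WA.trans (proj₁ (liftsⱼ x)) (WA.sym (proj₂ global j x)) , proj₂ (liftsⱼ x)
        in S.coinduce {heisenberg A} Φ (λ x → proj₂ (proj₂ (lifts x))) , λ v →
           proj₁ (proj₁ (lifts (proj₁ v))) e ,
           A.trans (proj₁ (proj₂ (lifts (proj₁ v))) e) (S.coinduce-induce {additive A} A.+-comm γ v)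

    product⇒factors : KijimaNishiHom A p G → ∀ j → KijimaNishiHom A p (H j)
    product⇒factors kn j V normal index α radical = βⱼ , βⱼ-radical , sum≈α
      where
      open CosetGroup (OpenSubgroup.subgroup V) normal index
      open Wreath isGroup
      open Inverse index using (to; from; strictlyInverseˡ)
      module V = OpenSubgroup V
      module S = Shapiro V index isGroup to-homo
      module ιⱼ = Homomorphism (ι j)

      χ-extended = extendTrivially (1 , ≡.subst (Finite (Group.setoid finGroup)) (≡.sym (ℕ.*-identityʳ p))
        (mkFinite id id id (λ _ → ≡.refl) (λ _ → ≡.refl))) j S.quotientMap
      χ : ContinuousHom G finGroup
      χ = proj₁ χ-extended
      χ-on = proj₁ (proj₂ χ-extended)
      χ-off = proj₂ (proj₂ χ-extended)

      α-extended = extendTrivially A-order j α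
      α̂ : ContinuousHom G (additive A)
      α̂ = proj₁ α-extended
      α̂-on = proj₁ (proj₂ α-extended)
      α̂-off = proj₂ (proj₂ α-extended)

      -- On the factor `j` this is the hypothesis on `α`; on every other factor `α̂` is zero.
      α̂-radical : IsRadical A α̂
      α̂-radical γ = lift-factorwise heis-order (heis₁ A) (heis₂ A) α̂ γ λ k → local (em _)
        where
        local : ∀ {k} → Dec (j ≡ k) → LiftsAlong (heis₁ A) (heis₂ A) (pullback k α̂) (pullback k γ)
        local (yes ≡.refl) =
          let (Φ , lifts) = radical (pullback j γ)
          in Φ , λ x → A.trans (proj₁ (lifts x)) (A.sym (α̂-on x)) , proj₂ (lifts x)
        local {k} (no j≢k) = heisenberg-inclusion₂ A ∘ʰ pullback k γ , λ x → A.sym (α̂-off k j≢k x) , A.refl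

      U : OpenSubgroup G
      U = ContinuousHom.kernelOpen χ

      -- The representatives are the images of those for `V`. With this choice the transfer for `V`
      -- is carried to the transfer for `U`, so the sums agree term by term.
      indexᵁ : HasIndex (OpenSubgroup.subgroup U) p
      indexᵁ = surjective⇒index isGroup χ λ s → ιⱼ.fun (from s) , ≡.trans (χ-on (from s)) (strictlyInverseˡ s)

      module Sᵁ = Shapiro U indexᵁ isGroup (ContinuousHom.homo χ)

      ι-mem : ∀ {x} → V.Mem x → OpenSubgroup.Mem U (ιⱼ.fun x)
      ι-mem {x} m = lift (≡.trans (χ-on x) (S.to-mem m))

      ι′ = restrictBoth V U (ι j) ι-mem
      module ι′ = Homomorphism ι′

      restrictToV : ∀ {P} → ContinuousHom (openSubgroup U) P → ContinuousHom (openSubgroup V) P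
      restrictToV = precompose ι′ (restrictBoth-continuous V U (ι j) ι-mem (ι-continuous j))

      solution = kn U (kernel-normal _ (ContinuousHom.homomorphism χ)) indexᵁ α̂ α̂-radical
      β = proj₁ solution
      β-radical = proj₁ (proj₂ solution)

      βⱼ : ContinuousHom (openSubgroup V) (additive A)
      βⱼ = restrictToV β

      sum≈α : ∀ x → transferSum V index A βⱼ x A.≈ α ⟨ x ⟩
      sum≈α x = A.trans
        (Sums.sum-cong-≋ A.+-commutativeMonoid λ s → ContinuousHom.cong β
          {ι′.fun (transfer V index s x)} {transfer U indexᵁ s (ιⱼ.fun x)} (ι-transfer s))
        (A.trans (proj₂ (proj₂ solution) (ιⱼ.fun x)) (α̂-on x))
        where
        ι-transfer : ∀ s → ιⱼ.fun (proj₁ (transfer V index s x)) G.≈ proj₁ (transfer U indexᵁ s (ιⱼ.fun x))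
        ι-transfer s = G.trans (ιⱼ.//-homo (H._∙_ j (from s) x) (from (to (H._∙_ j (from s) x))))
          (G.∙-cong (ιⱼ.homo (from s) x) (G.⁻¹-cong (G.reflexive (≡.cong (ιⱼ.fun ∘ from)
            (≡.trans (≡.sym (χ-on (H._∙_ j (from s) x))) (ContinuousHom.cong χ (ιⱼ.homo (from s) x)))))))

      -- The test class `γ` must first be extended from `V` to `U`. It is induced to a homomorphism
      -- of the factor into the wreath product, extended trivially to the whole group, and coinduced
      -- to `U`.
      βⱼ-radical : IsRadical A βⱼ
      βⱼ-radical γ =
        let (Φ , lifts) = β-radical (Sᵁ.coinduce {additive A} Γ above)
        in restrictToV Φ , λ v →
           proj₁ (lifts (ι′.fun v)) ,
           A.trans (proj₂ (lifts (ι′.fun v)))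
             (A.trans (proj₁ (proj₁ (proj₂ Γ-extended) (proj₁ v)) e)
               (S.coinduce-induce {additive A} A.+-comm γ v))
        where
        Γ-extended = extendTrivially (wreath-order {P = additive A} ≡.refl A-order) j (S.induce {additive A} γ)
        Γ : ContinuousHom G (wreath (additive A))
        Γ = proj₁ Γ-extended
        above : ∀ x → proj₂ (Γ ⟨ x ⟩) ≡ χ ⟨ x ⟩
        above = extensional (wreath-proj (additive A) ∘ʰ Γ) χ λ k x → agree (em _) x
          where
          agree : ∀ {k} → Dec (j ≡ k) → ∀ x → proj₂ (Γ ⟨ ι.fun k x ⟩) ≡ χ ⟨ ι.fun k x ⟩
          agree (yes ≡.refl)  x = ≡.trans (proj₂ (proj₁ (proj₂ Γ-extended) x)) (≡.sym (χ-on x))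
          agree {k} (no j≢k) x = ≡.trans (proj₂ (proj₂ (proj₂ Γ-extended) k j≢k x)) (≡.sym (χ-off k j≢k x))

  kijimaNishi : KijimaNishi p G ⇔ (∀ j → KijimaNishi p (H j))
  kijimaNishi = mk⇔
    (λ kn j → KijimaNishiHom⇒KijimaNishi p {H j}
      (product⇒factors (𝔽 p) (𝔽-order p) (heisenberg-order p) (KijimaNishi⇒KijimaNishiHom p {G} kn) j))
    (λ kn → KijimaNishiHom⇒KijimaNishi p {G}
      (factors⇒product (𝔽 p) (𝔽-order p) (heisenberg-order p)
        (λ j → KijimaNishi⇒KijimaNishiHom p {H j} (kn j))))
    where instance nonZero = Prime.prime⇒nonZero p-prime

proposition3p7 : (∀ a → ExcludedMiddle a) →
    ∀ {i c ℓ} (p : ℕ) → Prime p →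
    (I : Set i) (𝒢 : I → ProPGroup p c ℓ) →
    KijimaNishi p (freeProPProduct p 𝒢) ⇔
    (∀ j → KijimaNishi p (ProPGroup.topologicalGroup (𝒢 j)))
proposition3p7 em p p-prime I 𝒢 =
  FreeProPProduct.kijimaNishi em p-prime {H = λ j → ProPGroup.topologicalGroup (𝒢 j)} {freeProPProduct p 𝒢}
    (freeProPProduct-isFree em p p-prime 𝒢)
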